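{- Let $X$ be a mixed-stable sequence with respect to a full BST $T$, and assume $X$ is a whole multiple of its atomic sequence. Then $$\mathrm{cost}(GF,X,T)<\tfrac52\cdot\mathrm{cost}(OPT,X,T).$$ If $X$ is strongly-stable, then $\mathrm{cost}(GF,X,T)<2\cdot\mathrm{cost}(OPT,X,T)$.
   Context: Binary search tree model. Keys are $\{1,\dots,n\}$. A query sequence is $X=[x_1,\dots,x_m]$, and $T_0$ is an initial BST. An algorithm $A$ serves $x_1,\dots,x_m$ in order. Before serving $x_t$ it holds a BST $T_{t-1}$; it searches $x_t$ from the root and may then restructure the tree by rotations into $T_t$. Let $P_t$ be the set of nodes on the root-to-$x_t$ path of $T_{t-1}$, and let $U_t$ be the node set of the minimal subtree containing all edges rotated in transforming $T_{t-1}$ into $T_t$. The cost at time $t$ is $|P_t\cup U_t|$, and $\mathrm{cost}(A,X,T_0)$ is the sum of these costs. $OPT$ denotes an algorithm of minimum cost on $(X,T_0)$ that knows all of $X$ in advance. Greedy Future ($GF$). After finding $x_t$ in $T_{t-1}$, let $v_1<\dots<v_k$ be the keys on the root-to-$x_t$ path, set $v_0=-\infty$ and $v_{k+1}=+\infty$, and let $R_0,\dots,R_k$ be the subtrees hanging off this path. For each $i$, $\tau(v_i)$ is the smallest $s>t$ with $x_s\in(v_{i-1},v_{i+1})$, or $+\infty$ if there is none. $GF$ rearranges $v_1,\dots,v_k$ as a treap: a BST in key order and a heap in $\tau$, with the smallest $\tau$ at the top. Ties in $\tau$ are broken in favor of the node of smaller depth in $T_{t-1}$. It then reattaches $R_0,\dots,R_k$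 unchanged at their unique positions, giving $T_t$. Stable sequences. Let $T$ be a full binary search tree (every inner node has exactly two children), and let $X$ be a query sequence consisting only of keys stored at leaves of $T$. For an inner node $v$, let $X_v$ be the subsequence of $X$ consisting of the queries to keys in the subtree of $v$. - The node $v$ is strongly-stable if consecutive queries of $X_v$ alternate between the left and right subtrees of $v$. - The node $v$ is weakly-stable with a left bias if its left child $u$ is an inner node and $X_v$ repeats cyclically (from some starting phase) the pattern: a query in the left subtree of $u$, then one in the right subtree of $u$, then one in the right subtree of $v$. - Weakly-stable with a right bias is the mirror image: $u$ is the right child of $v$, and the pattern is right subtree of $u$, left subtree of $u$, left subtree of $v$. In both weakly-stable cases $u$ is called the favored child of $v$. $X$ (and $T$) is mixed-stable if every inner node of $T$ is strongly-stable or weakly-stable, and strongly-stable if every inner node is strongly-stable. The atomic sequence is the shortest such stable sequence all of whose repetitions are again such stable sequences. $X$ is a whole multiple of it if it is a concatenation of copies of it. -}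

module Defs where

open import Data.Fin.Base using (Fin; _<_)
open import Data.Fin.Properties using (<-cmp; _<?_) renaming (_≟_ to _≟ᶠ_)
open import Data.Fin.Subset using (Subset; ⁅_⁆; ⋃; _∪_; ∣_∣; _∈_; _⊆_)
open import Data.List.Base using (List; []; _∷_; length; map; filter; takeWhile; concat; replicate; allFin)
open import Data.List.Membership.DecPropositional using () renaming (_∈?_ to member?)
open import Data.List.Membership.Propositional using () renaming (_∈_ to _∈ˡ_)
open import Data.List.Relation.Unary.All using (All; all?)
open import Data.List.Relation.Unary.Linked using (Linked)
open import Data.Nat.Base as ℕ using (ℕ; _+_; _≤_)
open import Data.Product.Base using (_×_; _,_; ∃₂)
open import Data.Product.Relation.Binary.Lex.Strict using (×-Lex)
open import Data.Sum.Base using (_⊎_)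
open import Data.Tree.Binary using (Tree; leaf; node; foldr; module Prefix; module Infix; module Leaves)
open import Data.Unit.Base using (⊤; tt)
open import Function.Base using (id; const)
open import Relation.Binary.Construct.Closure.Equivalence using (EqClosure)
open import Relation.Binary.Construct.Closure.ReflexiveTransitive using (Star; ε; _◅_)
open import Relation.Binary.Definitions using (tri<; tri≈; tri>)
open import Relation.Binary.PropositionalEquality.Core using (_≡_; _≢_)
open import Relation.Nullary.Decidable using (Dec; ¬?; _×-dec_; _→-dec_)

private
  variable
    N L : Set
    n : ℕ

------------------------------------------------------------------------
-- Trees

-- `leaf tt` is the empty tree, so a leaf of the search tree in the
-- usual sense is `node (leaf tt) v (leaf tt)`.

BinTree : ℕ → Set
BinTree n = Tree (Fin n) ⊤

keys : BinTree n → List (Fin n)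
keys = Infix.toList

-- The key set {1,…,n} is represented by Fin n, and every key occurs.

IsBST : BinTree n → Set
IsBST {n} T = keys T ≡ allFin n

infix 4 _≼_

data _≼_ {N L : Set} (S : Tree N L) : Tree N L → Set where
  here  : S ≼ S
  left  : ∀ {l v r} → S ≼ l → S ≼ node l v r
  right : ∀ {l v r} → S ≼ r → S ≼ node l v r

-- Edge T v u : u is a child of v in T.

data Edge {N L : Set} : Tree N L → N → N → Set where
  toLeft  : ∀ {a u b v r} → Edge (node (node a u b) v r) v u
  toRight : ∀ {l v a u b} → Edge (node l v (node a u b)) v u
  left    : ∀ {l v r x y} → Edge l x y → Edge (node l v r) x y
  right   : ∀ {l v r x y} → Edge r x y → Edge (node l v r) x y

data Rotation {N L : Set} : Tree N L → Tree N L → Set where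
  rotateRight : ∀ a u b v c → Rotation (node (node a u b) v c) (node a u (node b v c))
  rotateLeft  : ∀ a u b v c → Rotation (node a u (node b v c)) (node (node a u b) v c)
  left        : ∀ {l l′ v r} → Rotation l l′ → Rotation (node l v r) (node l′ v r)
  right       : ∀ {l v r r′} → Rotation r r′ → Rotation (node l v r) (node l v r′)

rotatedEdge : {S T : Tree N L} → Rotation S T → N × N
rotatedEdge (rotateRight a u b v c) = v , u
rotatedEdge (rotateLeft a u b v c)  = u , v
rotatedEdge (left ρ)                = rotatedEdge ρ
rotatedEdge (right ρ)               = rotatedEdge ρ

rotatedEdges : {S T : Tree N L} → Star Rotation S T → List (N × N)
rotatedEdges ε       = []
rotatedEdges (ρ ◅ σ) = rotatedEdge ρ ∷ rotatedEdges σ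

------------------------------------------------------------------------
-- Search paths

-- The root-to-x path of T as a tree whose nodes are the path nodes and
-- whose leaves are the subtrees hanging off the path.

spine : Fin n → BinTree n → Tree (Fin n) (BinTree n)
spine x (leaf _)     = leaf (leaf tt)
spine x (node l v r) with <-cmp x v
... | tri< _ _ _ = node (spine x l) v (leaf r)
... | tri≈ _ _ _ = node (leaf l) v (leaf r)
... | tri> _ _ _ = node (leaf l) v (spine x r)

graft : Tree N (Tree N L) → Tree N L
graft = foldr node id

-- Listed from the root downwards.

path : Fin n → BinTree n → List (Fin n)
path x T = Prefix.toList (spine x T)

depth : BinTree n → Fin n → ℕ
depth T v = length (path v T)

pathSet : Fin n → BinTree n → Subset n
pathSet x T = ⋃ (map ⁅_⁆ (path x T))

------------------------------------------------------------------------
-- Algorithms and their cost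

Connected : BinTree n → Subset n → Set
Connected T U = ∀ {a b} → a ∈ U → b ∈ U →
                EqClosure (λ x y → Edge T x y × x ∈ U × y ∈ U) a b

Covers : Subset n → List (Fin n × Fin n) → Set
Covers U = All (λ (x , y) → x ∈ U × y ∈ U)

-- The node set of the minimal subtree of T containing all edges of E.
-- An edge rotated later in a sequence of rotations need not be present
-- in the initial tree, so containment refers to its endpoints.  Rotations
-- within a connected node set keep it connected; hence the set does not
-- depend on which tree of the sequence it is computed in.

record IsMinimalSubtree (T : BinTree n) (E : List (Fin n × Fin n)) (U : Subset n) : Set where
  field
    connected : Connected T U
    covers    : Covers U E
    least     : ∀ {V} → Connected T V → Covers V E → U ⊆ V

-- An execution of an arbitrary algorithm on a query sequence and an
-- initial tree.

data Run {n : ℕ} : BinTree n → List (Fin n) → Set where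
  done  : ∀ {T} → Run T []
  serve : ∀ {T T′ x X} (σ : Star Rotation T T′) (U : Subset n) →
          IsMinimalSubtree T (rotatedEdges σ) U →
          Run T′ X → Run T (x ∷ X)

cost : {T : BinTree n} {X : List (Fin n)} → Run T X → ℕ
cost done                           = 0
cost (serve {T = T} {x = x} _ U _ run) = ∣ pathSet x T ∪ U ∣ + cost run

IsOPT : {T : BinTree n} {X : List (Fin n)} → Run T X → Set
IsOPT {T = T} {X = X} run = (other : Run T X) → cost run ≤ cost other

------------------------------------------------------------------------
-- Greedy Future

-- For v = vᵢ on a path with keys v₁ < … < vₖ: y lies in the open
-- interval (vᵢ₋₁ , vᵢ₊₁), where v₀ = -∞ and vₖ₊₁ = +∞.

InGap : List (Fin n) → Fin n → Fin n → Set
InGap P v y = All (λ w → (w < v → w < y) × (v < w → y < w)) P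

inGap? : (P : List (Fin n)) (v y : Fin n) → Dec (InGap P v y)
inGap? P v y = all? (λ w → ((w <? v) →-dec (w <? y)) ×-dec ((v <? w) →-dec (y <? w))) P

-- Times are counted from the next query, and +∞ is encoded as the number
-- of remaining queries, which exceeds every time actually attained.

τ : List (Fin n) → List (Fin n) → Fin n → ℕ
τ P future v = length (takeWhile (λ y → ¬? (inGap? P v y)) future)

infix 4 _≺_

_≺_ : ℕ × ℕ → ℕ × ℕ → Set
_≺_ = ×-Lex _≡_ ℕ._<_ ℕ._<_

IsHeap : (N → ℕ × ℕ) → Tree N L → Set
IsHeap priority S = ∀ {v u} → Edge S v u → priority v ≺ priority u

-- After x is found in T, S rearranges the path as a treap, keeping the
-- order of the path keys and of the hanging subtrees.

record GFTree (x : Fin n) (future : List (Fin n)) (T T′ : BinTree n) : Set where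
  field
    S        : Tree (Fin n) (BinTree n)
    keyOrder : Infix.toList S ≡ Infix.toList (spine x T)
    hanging  : Leaves.toList S ≡ Leaves.toList (spine x T)
    heap     : IsHeap (λ v → τ (path x T) future v , depth T v) S
    result   : T′ ≡ graft S

-- GF rotates only edges between nodes of the search path.

data IsGF {n : ℕ} : {T : BinTree n} {X : List (Fin n)} → Run T X → Set where
  done  : ∀ {T} → IsGF (done {T = T})
  serve : ∀ {T T′ x X} {σ : Star Rotation T T′} {U m} {run : Run T′ X} →
          GFTree x X T T′ → Covers (pathSet x T) (rotatedEdges σ) →
          IsGF run → IsGF (serve {x = x} σ U m run)

------------------------------------------------------------------------
-- Stable sequences

data Inner {n : ℕ} : BinTree n → Set where
  inner : ∀ {a u b v c w d} → Inner (node (node a u b) v (node c w d))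

data Full {n : ℕ} : BinTree n → Set where
  single : ∀ {v} → Full (node (leaf tt) v (leaf tt))
  node   : ∀ {l v r} → Full l → Full r → Full (node l v r)

LeafKey : BinTree n → Fin n → Set
LeafKey T x = node (leaf tt) x (leaf tt) ≼ T

infix 8 _∣ᵗ_

_∣ᵗ_ : List (Fin n) → BinTree n → List (Fin n)
X ∣ᵗ S = filter (λ x → member? _≟ᶠ_ x (keys S)) X

Step : BinTree n → BinTree n → Fin n → Fin n → Set
Step a b x y = x ∈ˡ keys a × y ∈ˡ keys b

data Kind : Set where
  strong weakˡ weakʳ : Kind

-- Since the queries of X_v to leaf keys lie in the subtrees concerned, a
-- cyclic pattern from some starting phase is a condition on consecutive
-- queries.

data StableNode {n : ℕ} (Xᵥ : List (Fin n)) : Kind → BinTree n → Set where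
  alternating : ∀ {l v r} →
                Linked (λ x y → Step l r x y ⊎ Step r l x y) Xᵥ →
                StableNode Xᵥ strong (node l v r)
  leftBias    : ∀ {a u b v r} → Inner (node a u b) →
                Linked (λ x y → Step a b x y ⊎ Step b r x y ⊎ Step r a x y) Xᵥ →
                StableNode Xᵥ weakˡ (node (node a u b) v r)
  rightBias   : ∀ {l v a u b} → Inner (node a u b) →
                Linked (λ x y → Step b a x y ⊎ Step a l x y ⊎ Step l b x y) Xᵥ →
                StableNode Xᵥ weakʳ (node l v (node a u b))

-- X is mixed-stable with respect to T when this holds for some κ, and
-- strongly-stable when it holds for κ = const strong.

record StableAs (κ : Fin n → Kind) (T : BinTree n) (X : List (Fin n)) : Set where
  field
    leafQueries : All (LeafKey T) X
    stableNodes : ∀ {l v r} → node l v r ≼ T → Inner (node l v r) →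
                  StableNode (X ∣ᵗ node l v r) (κ v) (node l v r)

StronglyStable : BinTree n → List (Fin n) → Set
StronglyStable = StableAs (const strong)

repeat : {A : Set} → ℕ → List A → List A
repeat k A = concat (replicate k A)

-- A sequence and its repetitions are stable with the same kinds κ of
-- nodes.  The shortest length does not depend on the starting phases.

record IsAtomic (κ : Fin n → Kind) (T : BinTree n) (A : List (Fin n)) : Set where
  field
    nonempty   : A ≢ []
    repeatable : ∀ k → StableAs κ T (repeat k A)
    shortest   : ∀ {B} → B ≢ [] → (∀ k → StableAs κ T (repeat k B)) →
                 length A ≤ length B

IsWholeMultiple : (Fin n → Kind) → BinTree n → List (Fin n) → Set
IsWholeMultiple κ T X = ∃₂ λ A k → IsAtomic κ T A × X ≡ repeat (ℕ.suc k) A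

{-# OPTIONS --safe #-}

-- Under a stable sequence greedy future never changes T: at a path node v
-- the next query to the subtree of v lies in the gap of v, so v keeps its
-- priority over the path below it.  Hence GF pays one per query plus the
-- number |X_v| of queries to the subtree of each inner node v.
--
-- For the lower bound, Wilber's argument assigns to every node v of T its
-- transition point in the current tree: with L the keys up to v and R the
-- keys above v in the subtree of v, it is the deeper one of the topmost node
-- with key in L and the topmost node with key in R.  Transition points of
-- different nodes differ and none of them is the root, so a query costs at
-- least one plus the number of transition points it touches.  An untouched
-- transition point stays in place, and one in L (or R) is touched by every
-- query to L (or R).  Hence queries alternating between L and R touch it at
-- least once per alternating pair: |X_v|/2 times at a strongly-stable v, and
-- |X_v|/3 times at a weakly-stable v as well as at its favored child, which
-- together account for 5|X_v|/3 of the cost of GF.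

module Submission where

open import Defs
open import Data.Bool.Base using (Bool; true; false; not; if_then_else_; _xor_; T)
open import Data.Bool.Properties using (_≟_; not-¬; ¬-not; not-involutive)
open import Data.Fin.Base using (Fin; zero; suc; toℕ)
open import Data.Fin.Properties using (<-cmp; toℕ<n; toℕ-injective) renaming (_≟_ to _≟ᶠ_)
open import Data.Fin.Subset using (Subset; ⁅_⁆; ⋃; _∪_; ∣_∣; _∈_; _⊆_)
open import Data.Fin.Subset.Properties using (x∈p∪q⁺; x∈p∪q⁻; x∈⁅x⁆; x∈⁅y⁆⇒x≡y; ∣⁅x⁆∣≡1; ∣⊥∣≡0; ∉⊥; p⊆q⇒∣p∣≤∣q∣)
open import Data.List.Base using (List; []; _∷_; _++_; length; map; allFin; tabulate)
open import Data.List.Membership.DecPropositional using () renaming (_∈?_ to member?)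
open import Data.List.Membership.Propositional using () renaming (_∈_ to _∈ˡ_; _∉_ to _∉ˡ_)
open import Data.List.Membership.Propositional.Properties using (∈-++⁺ˡ; ∈-++⁺ʳ; ∈-++⁻)
open import Data.List.Properties
  using (++-assoc; map-++; map-tabulate; length-++; filter-++; filter-accept; filter-reject; ∷-injective; ∷-injectiveˡ)
open import Data.List.Relation.Unary.All as All using (All; []; _∷_)
open import Data.List.Relation.Unary.All.Properties using (++⁻ˡ)
open import Data.List.Relation.Unary.Any using (here; there)
open import Data.List.Relation.Unary.Linked as Linked using (Linked; []; _∷_)
open import Data.Nat.Base
open import Data.Nat.ListAction using (sum)
open import Data.Nat.ListAction.Properties using (sum-++)
open import Data.Nat.Properties hiding (_≟_; <-cmp)
open import Data.Nat.Solver using (module +-*-Solver)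
open import Data.Product.Base using (_×_; _,_; proj₁; proj₂; ∃; ∃₂)
open import Data.Product.Relation.Binary.Lex.Strict using (×-isStrictTotalOrder)
open import Data.Sum.Base using (_⊎_; inj₁; inj₂)
open import Data.Tree.Binary using (Tree; leaf; node; module Infix; module Leaves)
open import Data.Unit.Base using (tt)
open import Data.Vec.Base using (lookup; []; _∷_)
open import Data.Vec.Properties using ([]=⇒lookup)
open import Function.Base using (id; const; _∘_)
open import Relation.Binary.Construct.Closure.Equivalence as EqClosure using (EqClosure)
open import Relation.Binary.Construct.Closure.ReflexiveTransitive using (Star; ε; _◅_; _◅◅_)
open import Relation.Binary.Construct.Closure.Symmetric using (fwd)
open import Relation.Binary.Definitions using (tri<; tri≈; tri>)
open import Relation.Binary.PropositionalEquality
open import Relation.Binary.Structures using (module IsStrictTotalOrder)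
open import Relation.Nullary using (¬_; yes; no; contradiction)

private
  variable
    n lo mid hi : ℕ
    N L : Set

-- Search trees as intervals of keys

infix-++ : (t : Tree N L) (ks : List N) → Infix.toDiffList t ks ≡ Infix.toList t ++ ks
infix-++ (leaf _)     ks = refl
infix-++ (node l v r) ks = begin
  Infix.toDiffList l (v ∷ Infix.toDiffList r ks)      ≡⟨ infix-++ l _ ⟩
  Infix.toList l ++ v ∷ Infix.toDiffList r ks         ≡⟨ cong (λ z → Infix.toList l ++ v ∷ z) (infix-++ r ks) ⟩
  Infix.toList l ++ (v ∷ Infix.toList r) ++ ks        ≡⟨ ++-assoc (Infix.toList l) _ ks ⟨
  (Infix.toList l ++ v ∷ Infix.toList r) ++ ks        ≡⟨ cong (_++ ks) (infix-++ l _) ⟨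
  Infix.toList (node l v r) ++ ks                     ∎
  where open ≡-Reasoning

infix-node : (l : Tree N L) (v : N) (r : Tree N L) →
             Infix.toList (node l v r) ≡ Infix.toList l ++ v ∷ Infix.toList r
infix-node l v r = infix-++ l _

-- T is a search tree whose keys are exactly those k with lo ≤ k < hi.

data Ordered {n : ℕ} : ℕ → ℕ → BinTree n → Set where
  leaf : Ordered lo lo (leaf tt)
  node : ∀ {l v r} → Ordered lo (toℕ v) l → Ordered (suc (toℕ v)) hi r → Ordered lo hi (node l v r)

Ordered⇒≤ : {T : BinTree n} → Ordered lo hi T → lo ≤ hi
Ordered⇒≤ leaf       = ≤-refl
Ordered⇒≤ (node l r) = ≤-trans (Ordered⇒≤ l) (≤-trans (n≤1+n _) (Ordered⇒≤ r))

-- Mediates between `keys T ≡ allFin n` and `Ordered`: unlike `allFin n`, an interval of keys can be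
-- split at the root and handed to both subtrees.
data Consecutive {n : ℕ} : ℕ → ℕ → List (Fin n) → Set where
  []  : Consecutive lo lo []
  _∷_ : ∀ {x xs} → toℕ x ≡ lo → Consecutive (suc lo) hi xs → Consecutive lo hi (x ∷ xs)

tabulate-consecutive : ∀ {k lo} (f : Fin k → Fin n) → (∀ i → toℕ (f i) ≡ lo + toℕ i) →
                       Consecutive lo (lo + k) (tabulate f)
tabulate-consecutive {k = zero}  {lo} f eq rewrite +-identityʳ lo = []
tabulate-consecutive {k = suc k} {lo} f eq rewrite +-suc lo k =
  trans (eq zero) (+-identityʳ lo) ∷
  tabulate-consecutive (f ∘ suc) (λ i → trans (eq (suc i)) (+-suc lo (toℕ i)))

consecutive-split : ∀ xs {y : Fin n} {ys} → Consecutive lo hi (xs ++ y ∷ ys) →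
                    Consecutive lo (toℕ y) xs × Consecutive (suc (toℕ y)) hi ys
consecutive-split []       (refl ∷ c) = [] , c
consecutive-split (x ∷ xs) (eq ∷ c)   = let cˡ , cʳ = consecutive-split xs c in eq ∷ cˡ , cʳ

consecutive⇒ordered : (T : BinTree n) → Consecutive lo hi (keys T) → Ordered lo hi T
consecutive⇒ordered (leaf _)     []  = leaf
consecutive⇒ordered (node l v r) c   =
  let cˡ , cʳ = consecutive-split (keys l) (subst (Consecutive _ _) (infix-node l v r) c)
  in node (consecutive⇒ordered l cˡ) (consecutive⇒ordered r cʳ)

IsBST⇒Ordered : {T : BinTree n} → IsBST T → Ordered 0 n T
IsBST⇒Ordered {T = T} bst =
  consecutive⇒ordered T (subst (Consecutive _ _) (sym bst) (tabulate-consecutive id λ _ → refl))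

∈-left : ∀ {l r : Tree N L} {v x} → x ∈ˡ Infix.toList l → x ∈ˡ Infix.toList (node l v r)
∈-left {l = l} {r} {v} p = subst (_ ∈ˡ_) (sym (infix-node l v r)) (∈-++⁺ˡ p)

∈-root : ∀ {l r : Tree N L} {v} → v ∈ˡ Infix.toList (node l v r)
∈-root {l = l} {r} {v} = subst (_ ∈ˡ_) (sym (infix-node l v r)) (∈-++⁺ʳ (Infix.toList l) (here refl))

∈-right : ∀ {l r : Tree N L} {v x} → x ∈ˡ Infix.toList r → x ∈ˡ Infix.toList (node l v r)
∈-right {l = l} {r} {v} p = subst (_ ∈ˡ_) (sym (infix-node l v r)) (∈-++⁺ʳ (Infix.toList l) (there p))

∈-node⁻ : ∀ {l r : Tree N L} {v x} → x ∈ˡ Infix.toList (node l v r) → x ∈ˡ Infix.toList l ⊎ x ≡ v ⊎ x ∈ˡ Infix.toList r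
∈-node⁻ {l = l} {r} {v} p with ∈-++⁻ (Infix.toList l) (subst (_ ∈ˡ_) (infix-node l v r) p)
... | inj₁ q         = inj₁ q
... | inj₂ (here q)  = inj₂ (inj₁ q)
... | inj₂ (there q) = inj₂ (inj₂ q)

∈⇒range : ∀ {T : BinTree n} {x} → Ordered lo hi T → x ∈ˡ keys T → lo ≤ toℕ x × toℕ x < hi
∈⇒range leaf ()
∈⇒range (node {l = l} {r = r} oˡ oʳ) p with ∈-node⁻ {l = l} {r} p
... | inj₁ q           = let lo≤x , x<v = ∈⇒range oˡ q in lo≤x , <-trans x<v (Ordered⇒≤ oʳ)
... | inj₂ (inj₁ refl) = Ordered⇒≤ oˡ , Ordered⇒≤ oʳ
... | inj₂ (inj₂ q)    = let v<x , x<hi = ∈⇒range oʳ q in ≤-trans (Ordered⇒≤ oˡ) (<⇒≤ v<x) , x<hi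

range⇒∈ : ∀ {T : BinTree n} {x} → Ordered lo hi T → lo ≤ toℕ x → toℕ x < hi → x ∈ˡ keys T
range⇒∈ leaf lo≤x x<lo = contradiction lo≤x (<⇒≱ x<lo)
range⇒∈ {x = x} (node {l = l} {v} {r} oˡ oʳ) lo≤x x<hi with <-cmp x v
... | tri< x<v _ _  = ∈-left {l = l} {r} (range⇒∈ oˡ lo≤x x<v)
... | tri≈ _ refl _ = ∈-root {l = l} {r}
... | tri> _ _ v<x  = ∈-right {l = l} {r} (range⇒∈ oʳ v<x x<hi)

rotation-ordered : {S T : BinTree n} → Rotation S T → Ordered lo hi S → Ordered lo hi T
rotation-ordered (rotateRight _ _ _ _ _) (node (node a b) c) = node a (node b c)
rotation-ordered (rotateLeft _ _ _ _ _)  (node a (node b c)) = node (node a b) c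
rotation-ordered (left ρ)                (node l r)          = node (rotation-ordered ρ l) r
rotation-ordered (right ρ)               (node l r)          = node l (rotation-ordered ρ r)

rotations-ordered : {S T : BinTree n} → Star Rotation S T → Ordered lo hi S → Ordered lo hi T
rotations-ordered ε       o = o
rotations-ordered (ρ ◅ σ) o = rotations-ordered σ (rotation-ordered ρ o)

-- Wilber's bound: transition points

data Place : Set where
  before within after : Place

-- The position of a key relative to two adjacent intervals, while `Place` refers to a single one.
data Zone : Set where
  below first second above : Zone

choose : {A : Set} → Place → A → A → A → A
choose before x y z = x
choose within x y z = y
choose after  x y z = z

select : {A : Set} → Zone → A → A → A → A → A
select below  w x y z = w
select first  w x y z = x
select second w x y z = y
select above  w x y z = z

inFirst inSecond inEither : Zone → Place
inFirst  i = select i before within after  after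
inSecond i = select i before before within after
inEither i = select i before within within after

-- The linear order `below`, `first`, `second`, `above`. A map of keys that is monotone for it cuts
-- them into four consecutive blocks.
data _≤ᶻ_ : Zone → Zone → Set where
  below≤  : ∀ {i} → below ≤ᶻ i
  refl≤   : ∀ {i} → i ≤ᶻ i
  first≤second : first ≤ᶻ second
  ≤above  : ∀ {i} → i ≤ᶻ above

Monotone : (Fin n → Zone) → Set
Monotone z = ∀ {u v} → toℕ u < toℕ v → z u ≤ᶻ z v

bit : Bool → ℕ
bit b = if b then 1 else 0

-- hit c S T tells whether the topmost node of T that is placed within
-- the interval described by c belongs to S.

hit : (Fin n → Place) → Subset n → BinTree n → ℕ
hit c S (leaf _)     = 0
hit c S (node l v r) = choose (c v) (hit c S r) (bit (lookup S v)) (hit c S l)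

-- The transition point is the deeper of the topmost nodes of the two
-- intervals described by z.

touch : (Fin n → Zone) → Subset n → BinTree n → ℕ
touch z S (leaf _)     = 0
touch z S (node l v r) =
  select (z v) (touch z S r) (hit (inSecond ∘ z) S r) (hit (inFirst ∘ z) S l) (touch z S l)

-- True when the transition point lies in the second interval.

side : (Fin n → Zone) → BinTree n → Bool
side z (leaf _)     = false
side z (node l v r) = select (z v) (side z r) true false (side z l)

-- The first node met in either interval is the topmost node both of its own interval and of the
-- union; the topmost node of the other interval is then the transition point. So both sides count
-- the same two nodes.
touch-hit : ∀ (z : Fin n → Zone) S T →
            touch z S T + hit (inEither ∘ z) S T ≡ hit (inFirst ∘ z) S T + hit (inSecond ∘ z) S T
touch-hit z S (leaf _) = refl
touch-hit z S (node l v r) with z v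
... | below  = touch-hit z S r
... | first  = +-comm (hit (inSecond ∘ z) S r) _
... | second = refl
... | above  = touch-hit z S l

hit-cong : ∀ {c d : Fin n → Place} → c ≗ d → ∀ S T → hit c S T ≡ hit d S T
hit-cong c≗d S (leaf _)     = refl
hit-cong {c = c} {d} c≗d S (node l v r)
  rewrite c≗d v | hit-cong c≗d S l | hit-cong c≗d S r = refl

data _≤ᵖ_ : Place → Place → Set where
  before≤ : ∀ {p} → before ≤ᵖ p
  refl≤   : ∀ {p} → p ≤ᵖ p
  ≤after  : ∀ {p} → p ≤ᵖ after

inFirst-mono : ∀ {i j} → i ≤ᶻ j → inFirst i ≤ᵖ inFirst j
inFirst-mono below≤       = before≤
inFirst-mono refl≤        = refl≤
inFirst-mono first≤second = ≤after
inFirst-mono ≤above       = ≤after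

inSecond-mono : ∀ {i j} → i ≤ᶻ j → inSecond i ≤ᵖ inSecond j
inSecond-mono below≤       = before≤
inSecond-mono refl≤        = refl≤
inSecond-mono first≤second = before≤
inSecond-mono ≤above       = ≤after

-- The topmost node changes only if both `u` and `v` lie in the interval. It is then `v` before and
-- `u` after the rotation, and both belong to `S`.
hit-rotate : ∀ {c : Fin n → Place} {S u v} → c u ≤ᵖ c v → u ∈ S → v ∈ S → ∀ {A B C} →
             hit c S (node (node A u B) v C) ≡ hit c S (node A u (node B v C))
hit-rotate {c = c} {S} {u} {v} cu≤cv u∈S v∈S with c u | c v | cu≤cv
... | before | before | _ = refl
... | before | within | _ = refl
... | before | after  | _ = refl
... | within | within | _ = trans (cong bit ([]=⇒lookup v∈S)) (sym (cong bit ([]=⇒lookup u∈S)))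
... | within | after  | _ = refl
... | after  | after  | _ = refl

-- In all cases but one both trees unfold to the same touch and the same side. If `u` is in the
-- first interval and `v` in the second, the rotation flips the side; but the transition point is
-- `u` before and `v` after, both in `S`, so the touch is 1 and the claim about sides is vacuous.
touch-rotate : ∀ {z : Fin n → Zone} {S u v} → z u ≤ᶻ z v → u ∈ S → v ∈ S → ∀ {A B C} →
               let P = node (node A u B) v C; Q = node A u (node B v C) in
               touch z S P ≡ touch z S Q × (touch z S P ≡ 0 → side z P ≡ side z Q)
touch-rotate {z = z} {S} {u} {v} zu≤zv u∈S v∈S with z u | z v | zu≤zv
... | below  | below  | _ = refl , λ _ → refl
... | below  | first  | _ = refl , λ _ → refl
... | below  | second | _ = refl , λ _ → refl
... | below  | above  | _ = refl , λ _ → refl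
... | first  | first  | _ = refl , λ _ → refl
... | first  | above  | _ = refl , λ _ → refl
... | second | second | _ = refl , λ _ → refl
... | second | above  | _ = refl , λ _ → refl
... | above  | above  | _ = refl , λ _ → refl
... | first  | second | _ rewrite []=⇒lookup u∈S | []=⇒lookup v∈S = refl , λ ()

hit-rotation : ∀ {c : Fin n → Place} → (∀ {u v} → toℕ u < toℕ v → c u ≤ᵖ c v) →
               ∀ {S P Q lo hi} (ρ : Rotation P Q) → Ordered lo hi P →
               proj₁ (rotatedEdge ρ) ∈ S → proj₂ (rotatedEdge ρ) ∈ S → hit c S P ≡ hit c S Q
hit-rotation mono (rotateRight a u b v c) (node (node _ oᵇ) _) v∈S u∈S =
  hit-rotate (mono (Ordered⇒≤ oᵇ)) u∈S v∈S {a} {b} {c}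
hit-rotation mono (rotateLeft a u b v c) (node _ (node oᵇ _)) u∈S v∈S =
  sym (hit-rotate (mono (Ordered⇒≤ oᵇ)) u∈S v∈S {a} {b} {c})
hit-rotation {c = c} mono (left {v = v} ρ) (node o _) p q =
  cong (choose (c v) _ _) (hit-rotation mono ρ o p q)
hit-rotation {c = c} mono (right {v = v} ρ) (node _ o) p q =
  cong (λ h → choose (c v) h _ _) (hit-rotation mono ρ o p q)

touch-rotation : ∀ {z : Fin n → Zone} → Monotone z → ∀ {S P Q lo hi} (ρ : Rotation P Q) → Ordered lo hi P →
                 proj₁ (rotatedEdge ρ) ∈ S → proj₂ (rotatedEdge ρ) ∈ S →
                 touch z S P ≡ touch z S Q × (touch z S P ≡ 0 → side z P ≡ side z Q)
touch-rotation mono (rotateRight a u b v c) (node (node _ oᵇ) _) v∈S u∈S =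
  touch-rotate (mono (Ordered⇒≤ oᵇ)) u∈S v∈S {a} {b} {c}
touch-rotation mono (rotateLeft a u b v c) (node _ (node oᵇ _)) u∈S v∈S =
  let t , s = touch-rotate (mono (Ordered⇒≤ oᵇ)) u∈S v∈S {a} {b} {c}
  in sym t , λ t≡0 → sym (s (trans t t≡0))
touch-rotation {z = z} mono (left {v = v} ρ) (node o _) p q
  with z v | touch-rotation mono ρ o p q | hit-rotation (inFirst-mono ∘ mono) ρ o p q
... | below  | _ | _ = refl , λ _ → refl
... | first  | _ | _ = refl , λ _ → refl
... | second | _ | h = h , λ _ → refl
... | above  | t | _ = t
touch-rotation {z = z} mono (right {v = v} ρ) (node _ o) p q
  with z v | touch-rotation mono ρ o p q | hit-rotation (inSecond-mono ∘ mono) ρ o p q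
... | below  | t | _ = t
... | first  | _ | h = h , λ _ → refl
... | second | _ | _ = refl , λ _ → refl
... | above  | _ | _ = refl , λ _ → refl

-- For a fixed `S` the touch is invariant under rotations with both ends in `S`. A point untouched
-- in `P` is therefore untouched in every intermediate tree and keeps its side at each rotation.
untouched⇒side : ∀ {z : Fin n → Zone} → Monotone z → ∀ {S P Q lo hi} (σ : Star Rotation P Q) → Ordered lo hi P →
                 Covers S (rotatedEdges σ) → touch z S P ≡ 0 → side z P ≡ side z Q
untouched⇒side mono ε       o []              _ = refl
untouched⇒side mono (ρ ◅ σ) o ((p , q) ∷ cov) e =
  let t , s = touch-rotation mono ρ o p q
  in trans (s e) (untouched⇒side mono σ (rotation-ordered ρ o) cov (trans (sym t) e))

-- As long as the descent has not met the interval, which contains `x`, the node at hand sends the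
-- interval and `x` the same way. So the topmost node of the interval lies on the path to `x`.
hit-forced : ∀ {c : Fin n → Place} → (∀ {u v} → toℕ u < toℕ v → c u ≤ᵖ c v) →
             ∀ {x S T lo hi} → Ordered lo hi T → lo ≤ toℕ x → toℕ x < hi →
             (∀ {w} → w ∈ˡ path x T → w ∈ S) → c x ≡ within → hit c S T ≡ 1
hit-forced mono leaf lo≤x x<lo _ _ = contradiction lo≤x (<⇒≱ x<lo)
hit-forced {c = c} mono {x} {S} (node {v = v} oˡ oʳ) lo≤x x<hi ⊆S eq with <-cmp x v
... | tri≈ _ refl _ rewrite eq | []=⇒lookup (⊆S (here refl)) = refl
... | tri< x<v _ _ with c v | subst (_≤ᵖ c v) eq (mono x<v)
...   | within | _ rewrite []=⇒lookup (⊆S (here refl)) = refl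
...   | after  | _ = hit-forced mono oˡ lo≤x x<v (⊆S ∘ there) eq
hit-forced {c = c} mono {x} {S} (node {v = v} oˡ oʳ) lo≤x x<hi ⊆S eq | tri> _ _ v<x
  with c v | subst (c v ≤ᵖ_) eq (mono v<x)
...   | within | _ rewrite []=⇒lookup (⊆S (here refl)) = refl
...   | before | _ = hit-forced mono oʳ v<x x<hi (⊆S ∘ there) eq

zoneOf : Bool → Zone
zoneOf false = first
zoneOf true  = second

zoneOf≢below : ∀ {b} → zoneOf b ≢ below
zoneOf≢below {false} ()
zoneOf≢below {true}  ()

zoneOf≢above : ∀ {b} → zoneOf b ≢ above
zoneOf≢above {false} ()
zoneOf≢above {true}  ()

zoneOf≰below : ∀ {b} → ¬ (zoneOf b ≤ᶻ below)
zoneOf≰below {false} ()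
zoneOf≰below {true}  ()

above≰zoneOf : ∀ {b} → ¬ (above ≤ᶻ zoneOf b)
above≰zoneOf {false} ()
above≰zoneOf {true}  ()

-- The transition point is the topmost node of the interval containing `x`. Nodes outside both
-- intervals send it and `x` the same way; at the first node of the other interval the rest is
-- `hit-forced`.
touch-forced : ∀ {z : Fin n → Zone} → Monotone z →
               ∀ {x S T lo hi} → Ordered lo hi T → lo ≤ toℕ x → toℕ x < hi →
               (∀ {w} → w ∈ˡ path x T → w ∈ S) → z x ≡ zoneOf (side z T) → touch z S T ≡ 1
touch-forced mono leaf lo≤x x<lo _ _ = contradiction lo≤x (<⇒≱ x<lo)
touch-forced {z = z} mono {x} {S} (node {v = v} oˡ oʳ) lo≤x x<hi ⊆S eq with <-cmp x v
-- The root cannot be `x` itself: inside one interval it puts the transition point into the other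
-- one, and outside both its zone is no `zoneOf`.
... | tri≈ _ refl _ with z v | eq
...   | below  | e = contradiction (sym e) zoneOf≢below
...   | above  | e = contradiction (sym e) zoneOf≢above
touch-forced {z = z} mono {x} {S} (node {v = v} oˡ oʳ) lo≤x x<hi ⊆S eq | tri< x<v _ _
  with z v | eq | subst (_≤ᶻ z v) eq (mono x<v)
...   | below  | _ | p = contradiction p zoneOf≰below
...   | second | e | _ = hit-forced (inFirst-mono ∘ mono) oˡ lo≤x x<v (⊆S ∘ there) (cong inFirst e)
...   | above  | e | _ = touch-forced mono oˡ lo≤x x<v (⊆S ∘ there) e
touch-forced {z = z} mono {x} {S} (node {v = v} oˡ oʳ) lo≤x x<hi ⊆S eq | tri> _ _ v<x
  with z v | eq | subst (z v ≤ᶻ_) eq (mono v<x)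
...   | below  | e | _ = touch-forced mono oʳ v<x x<hi (⊆S ∘ there) e
...   | first  | e | _ = hit-forced (inSecond-mono ∘ mono) oʳ v<x x<hi (⊆S ∘ there) (cong inSecond e)
...   | above  | _ | p = contradiction p above≰zoneOf

-- Summing the touches over the nodes of a reference tree

weight : Subset n → List (Fin n) → ℕ
weight S ks = sum (map (bit ∘ lookup S) ks)

weight-node : ∀ (S : Subset n) l v r →
              weight S (keys (node l v r)) ≡ weight S (keys l) + (bit (lookup S v) + weight S (keys r))
weight-node S l v r rewrite infix-node l v r | map-++ (bit ∘ lookup S) (keys l) (v ∷ keys r) =
  sum-++ (map (bit ∘ lookup S) (keys l)) _

weight-allFin : ∀ {n} (S : Subset n) → weight S (allFin n) ≡ ∣ S ∣
weight-allFin {n} S = trans (cong sum (map-tabulate id (bit ∘ lookup S))) (tabulated S)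
  where
  tabulated : ∀ {n} (S : Subset n) → sum (tabulate (bit ∘ lookup S)) ≡ ∣ S ∣
  tabulated []          = refl
  tabulated (true ∷ S)  = cong suc (tabulated S)
  tabulated (false ∷ S) = tabulated S

place : ℕ → ℕ → Fin n → Place
place lo hi k = if toℕ k <ᵇ lo then before else if toℕ k <ᵇ hi then within else after

-- Used with `mid` equal to `suc (toℕ v)` for a node `v` whose subtree holds the keys from `lo` up
-- to but excluding `hi`: the first interval is the left subtree together with `v`, the second is
-- the right subtree.
zone : ℕ → ℕ → ℕ → Fin n → Zone
zone lo mid hi k =
  if toℕ k <ᵇ lo then below else if toℕ k <ᵇ mid then first else if toℕ k <ᵇ hi then second else above

<ᵇ-true : ∀ {a b} → a < b → (a <ᵇ b) ≡ true
<ᵇ-true {a} {b} a<b with a <ᵇ b | <⇒<ᵇ a<b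
... | true | _ = refl

<ᵇ-false : ∀ {a b} → b ≤ a → (a <ᵇ b) ≡ false
<ᵇ-false {a} {b} b≤a with a <ᵇ b in eq
... | false = refl
... | true  = contradiction b≤a (<⇒≱ (<ᵇ⇒< a b (subst T (sym eq) tt)))

<ᵇ-mono : ∀ a {b c} → b ≤ c → (a <ᵇ b) ≡ true → (a <ᵇ c) ≡ true
<ᵇ-mono a {b} b≤c eq = <ᵇ-true (<-≤-trans (<ᵇ⇒< a b (subst T (sym eq) tt)) b≤c)

<ᵇ-anti : ∀ {a b} c → a < b → (b <ᵇ c) ≡ true → (a <ᵇ c) ≡ true
<ᵇ-anti {b = b} c a<b eq = <ᵇ-true (<-trans a<b (<ᵇ⇒< b c (subst T (sym eq) tt)))

zone-first : ∀ {lo mid hi} {k : Fin n} → lo ≤ toℕ k → toℕ k < mid → zone lo mid hi k ≡ first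
zone-first p q rewrite <ᵇ-false p | <ᵇ-true q = refl

zone-second : ∀ {lo mid hi} {k : Fin n} → lo ≤ mid → mid ≤ toℕ k → toℕ k < hi → zone lo mid hi k ≡ second
zone-second o p q rewrite <ᵇ-false (≤-trans o p) | <ᵇ-false p | <ᵇ-true q = refl

zone-mono : ∀ lo mid hi → Monotone {n} (zone lo mid hi)
zone-mono lo mid hi {u} {v} u<v
  with toℕ u <ᵇ lo in u₁ | toℕ v <ᵇ lo in v₁ | toℕ u <ᵇ mid in u₂ | toℕ v <ᵇ mid in v₂ | toℕ u <ᵇ hi in u₃ | toℕ v <ᵇ hi in v₃
... | true  | _     | _     | _     | _     | _     = below≤
... | false | true  | _     | _     | _     | _     = contradiction (trans (sym (<ᵇ-anti lo u<v v₁)) u₁) λ ()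
... | false | false | true  | true  | _     | _     = refl≤
... | false | false | true  | false | _     | true  = first≤second
... | false | false | true  | false | _     | false = ≤above
... | false | false | false | true  | _     | _     = contradiction (trans (sym (<ᵇ-anti mid u<v v₂)) u₂) λ ()
... | false | false | false | false | true  | true  = refl≤
... | false | false | false | false | _     | false = ≤above
... | false | false | false | false | false | true  = contradiction (trans (sym (<ᵇ-anti hi u<v v₃)) u₃) λ ()

inFirst-zone : ∀ lo mid hi → lo ≤ mid → inFirst ∘ zone {n} lo mid hi ≗ place lo mid
inFirst-zone lo mid hi _ k with toℕ k <ᵇ lo | toℕ k <ᵇ mid | toℕ k <ᵇ hi
... | true  | _     | _     = refl
... | false | true  | _     = refl
... | false | false | true  = refl
... | false | false | false = refl

inSecond-zone : ∀ {lo mid} hi → lo ≤ mid → inSecond ∘ zone {n} lo mid hi ≗ place mid hi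
inSecond-zone {lo = lo} {mid} hi lo≤mid k
  with toℕ k <ᵇ lo in eq | toℕ k <ᵇ mid in eq′ | toℕ k <ᵇ hi
... | true  | true  | _     = refl
... | true  | false | _     = contradiction (trans (sym eq′) (<ᵇ-mono (toℕ k) lo≤mid eq)) λ ()
... | false | true  | _     = refl
... | false | false | true  = refl
... | false | false | false = refl

inEither-zone : ∀ lo {mid hi} → mid ≤ hi → inEither ∘ zone {n} lo mid hi ≗ place lo hi
inEither-zone lo {mid} {hi} mid≤hi k with toℕ k <ᵇ lo | toℕ k <ᵇ mid in eq | toℕ k <ᵇ hi in eq′
... | true  | _     | _     = refl
... | false | true  | true  = refl
... | false | true  | false = contradiction (trans (sym eq′) (<ᵇ-mono (toℕ k) mid≤hi eq)) λ ()
... | false | false | true  = refl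
... | false | false | false = refl

hit-empty : ∀ lo (S : Subset n) T → hit (place lo lo) S T ≡ 0
hit-empty lo S (leaf _)     = refl
hit-empty lo S (node l v r) with toℕ v <ᵇ lo
... | true  = hit-empty lo S r
... | false = hit-empty lo S l

-- Both descents agree until they meet a node of the shorter interval or `v` itself. In the sum over
-- all nodes this lets the weight of `v` pay for its membership in its own first interval.
hit-extend : ∀ lo v (S : Subset n) T →
             hit (place lo (suc (toℕ v))) S T ≤ hit (place lo (toℕ v)) S T + bit (lookup S v)
hit-extend lo v S (leaf _) = z≤n
hit-extend lo v S (node l k r) with toℕ k <ᵇ lo | toℕ k <ᵇ suc (toℕ v) in eq | toℕ k <ᵇ toℕ v in eq′
... | true  | _     | _     = hit-extend lo v S r
... | false | true  | true  = m≤m+n _ _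
... | false | false | true  = contradiction (trans (sym eq) (<ᵇ-mono (toℕ k) (n≤1+n (toℕ v)) eq′)) λ ()
... | false | false | false = hit-extend lo v S l
... | false | true  | false with toℕ-injective {i = k} {v} (≤-antisym
        (s≤s⁻¹ (<ᵇ⇒< (toℕ k) (suc (toℕ v)) (subst T (sym eq) tt)))
        (≮⇒≥ λ k<v → contradiction (trans (sym (<ᵇ-true k<v)) eq′) λ ()))
...   | refl = m≤n+m _ _

-- The first tree is the fixed reference tree whose nodes index the transition points; the last one
-- is the current tree in which they are located.
touchSum : ℕ → ℕ → BinTree n → Subset n → BinTree n → ℕ
touchSum lo hi (leaf _)     S T = 0
touchSum lo hi (node l v r) S T =
  touch (zone lo (suc (toℕ v)) hi) S T + (touchSum lo (toℕ v) l S T + touchSum (suc (toℕ v)) hi r S T)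

-- The topmost nodes of the two intervals at v are the topmost node of
-- their union and the transition point of v: hence transition points of
-- different nodes differ.

touchSum-bound : ∀ {P : BinTree n} → Ordered lo hi P → ∀ S T →
                 touchSum lo hi P S T + hit (place lo hi) S T ≤ weight S (keys P)
touchSum-bound (leaf {lo}) S T = ≤-reflexive (hit-empty lo S T)
touchSum-bound {lo = lo} {hi} (node {l = l} {v} {r} oˡ oʳ) S T = begin
  t + (sˡ + sʳ) + hit (place lo hi) S T
    ≡⟨ cong (t + (sˡ + sʳ) +_) (hit-cong (inEither-zone lo (Ordered⇒≤ oʳ)) S T) ⟨
  t + (sˡ + sʳ) + hit (inEither ∘ z) S T
    ≡⟨ solve 4 (λ t a b h → t :+ (a :+ b) :+ h := (t :+ h) :+ (a :+ b)) refl t sˡ sʳ _ ⟩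
  (t + hit (inEither ∘ z) S T) + (sˡ + sʳ)
    ≡⟨ cong (_+ (sˡ + sʳ)) (touch-hit z S T) ⟩
  (hit (inFirst ∘ z) S T + hit (inSecond ∘ z) S T) + (sˡ + sʳ)
    ≡⟨ cong₂ (λ p q → (p + q) + (sˡ + sʳ)) (hit-cong (inFirst-zone lo (suc (toℕ v)) hi lo≤) S T) (hit-cong (inSecond-zone hi lo≤) S T) ⟩
  (hit (place lo (suc (toℕ v))) S T + hit (place (suc (toℕ v)) hi) S T) + (sˡ + sʳ)
    ≤⟨ +-monoˡ-≤ (sˡ + sʳ) (+-monoˡ-≤ (hit (place (suc (toℕ v)) hi) S T) (hit-extend lo v S T)) ⟩
  ((hit (place lo (toℕ v)) S T + b) + hit (place (suc (toℕ v)) hi) S T) + (sˡ + sʳ)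
    ≡⟨ solve 5 (λ p b q x y → ((p :+ b) :+ q) :+ (x :+ y) := (x :+ p) :+ (b :+ (y :+ q))) refl
         (hit (place lo (toℕ v)) S T) b (hit (place (suc (toℕ v)) hi) S T) sˡ sʳ ⟩
  (sˡ + hit (place lo (toℕ v)) S T) + (b + (sʳ + hit (place (suc (toℕ v)) hi) S T))
    ≤⟨ +-mono-≤ (touchSum-bound oˡ S T) (+-monoʳ-≤ b (touchSum-bound oʳ S T)) ⟩
  weight S (keys l) + (b + weight S (keys r))
    ≡⟨ weight-node S l v r ⟨
  weight S (keys (node l v r)) ∎
  where
  open ≤-Reasoning
  open +-*-Solver
  z = zone lo (suc (toℕ v)) hi
  b = bit (lookup S v)
  t = touch z S T
  sˡ = touchSum lo (toℕ v) l S T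
  sʳ = touchSum (suc (toℕ v)) hi r S T
  lo≤ = m≤n⇒m≤1+n (Ordered⇒≤ oˡ)

touches : (Fin n → Zone) → {T : BinTree n} {X : List (Fin n)} → Run T X → ℕ
touches z done                                 = 0
touches z (serve {T = T} {x = x} _ U _ run) = touch z (pathSet x T ∪ U) T + touches z run

allTouches : ∀ {n} → ℕ → ℕ → BinTree n → {T : BinTree n} {X : List (Fin n)} → Run T X → ℕ
allTouches lo hi (leaf _)     run = 0
allTouches lo hi (node l v r) run =
  touches (zone lo (suc (toℕ v)) hi) run +
  (allTouches lo (toℕ v) l run + allTouches (suc (toℕ v)) hi r run)

allTouches-done : ∀ lo hi (P : BinTree n) {T} → allTouches lo hi P (done {T = T}) ≡ 0
allTouches-done lo hi (leaf _)     = refl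
allTouches-done lo hi (node l v r) = cong₂ _+_ (allTouches-done _ _ l) (allTouches-done _ _ r)

allTouches-serve : ∀ lo hi (P : BinTree n) {T T′ x X} (σ : Star Rotation T T′) U m (run : Run T′ X) →
                   allTouches lo hi P (serve {x = x} σ U m run) ≡
                   touchSum lo hi P (pathSet x T ∪ U) T + allTouches lo hi P run
allTouches-serve lo hi (leaf _)     σ U m run = refl
allTouches-serve lo hi (node l v r) {T} {x = x} σ U m run
  rewrite allTouches-serve lo (toℕ v) l {x = x} σ U m run
        | allTouches-serve (suc (toℕ v)) hi r {x = x} σ U m run =
  solve 6 (λ a b c d e f → (a :+ b) :+ ((c :+ d) :+ (e :+ f)) := (a :+ (c :+ e)) :+ (b :+ (d :+ f))) refl
    (touch (zone lo (suc (toℕ v)) hi) (pathSet x T ∪ U) T) (touches (zone lo (suc (toℕ v)) hi) run)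
    (touchSum lo (toℕ v) l (pathSet x T ∪ U) T) (allTouches lo (toℕ v) l run)
    (touchSum (suc (toℕ v)) hi r (pathSet x T ∪ U) T) (allTouches (suc (toℕ v)) hi r run)
  where open +-*-Solver

∈-⋃ : ∀ {w : Fin n} {ws} → w ∈ˡ ws → w ∈ ⋃ (map ⁅_⁆ ws)
∈-⋃ (here refl)             = x∈p∪q⁺ (inj₁ (x∈⁅x⁆ _))
∈-⋃ {ws = v ∷ ws} (there p) = x∈p∪q⁺ {p = ⁅ v ⁆} (inj₂ (∈-⋃ p))

path⊆touched : ∀ {x w : Fin n} {T} U → w ∈ˡ path x T → w ∈ pathSet x T ∪ U
path⊆touched U p = x∈p∪q⁺ (inj₁ (∈-⋃ p))

root∈path : ∀ (x : Fin n) {l v r} → v ∈ˡ path x (node l v r)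
root∈path x {v = v} with <-cmp x v
... | tri< _ _ _ = here refl
... | tri≈ _ _ _ = here refl
... | tri> _ _ _ = here refl

hit-root : ∀ {S : Subset n} {l v r} → v ∈ S → hit (place 0 n) S (node l v r) ≡ 1
hit-root {n} {v = v} v∈S rewrite <ᵇ-true (toℕ<n v) | []=⇒lookup v∈S = refl

hit-path : ∀ {T : BinTree n} → Ordered 0 n T → ∀ (x : Fin n) U →
           hit (place 0 n) (pathSet x T ∪ U) T ≡ 1
hit-path leaf ()
hit-path (node {l = l} {v} {r} _ _) x U = hit-root {l = l} {v} {r} (path⊆touched {x = x} {T = node l v r} U (root∈path x))

-- The root is touched by every query and is never a transition point.

cost-bound : ∀ (P : BinTree n) {T : BinTree n} {X} → keys P ≡ allFin n → Ordered 0 n T → (run : Run T X) →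
             length X + allTouches 0 n P run ≤ cost run
cost-bound P bst o done = ≤-reflexive (allTouches-done 0 _ P)
cost-bound {n} P bst o (serve {T = T} {x = x} {X} σ U m run) = begin
  suc (length X) + allTouches 0 n P (serve {x = x} σ U m run)
    ≡⟨ cong (suc (length X) +_) (allTouches-serve 0 n P {x = x} σ U m run) ⟩
  suc (length X) + (t + c)
    ≡⟨ solve 3 (λ l t c → (con 1 :+ l) :+ (t :+ c) := (t :+ con 1) :+ (l :+ c)) refl (length X) t c ⟩
  (t + 1) + (length X + c)
    ≡⟨ cong (λ h → (t + h) + (length X + c)) (hit-path o x U) ⟨
  (t + hit (place 0 n) S T) + (length X + c)
    ≤⟨ +-mono-≤ (touchSum-bound (IsBST⇒Ordered {T = P} bst) S T) (cost-bound P bst (rotations-ordered σ o) run) ⟩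
  weight S (keys P) + cost run
    ≡⟨ cong (λ ks → weight S ks + cost run) bst ⟩
  weight S (allFin n) + cost run
    ≡⟨ cong (_+ cost run) (weight-allFin S) ⟩
  ∣ S ∣ + cost run ∎
  where
  open ≤-Reasoning
  open +-*-Solver
  S = pathSet x T ∪ U
  t = touchSum 0 n P S T
  c = allTouches 0 n P run

-- Stable nodes

-- Opaque so that later proofs rewrite with the three equations instead of unfolding the filter and
-- its membership tests.
opaque
  count : List (Fin n) → BinTree n → ℕ
  count X S = length (X ∣ᵗ S)

  count-[] : (S : BinTree n) → count [] S ≡ 0
  count-[] S = refl

  count-∈ : ∀ {x : Fin n} X S → x ∈ˡ keys S → count (x ∷ X) S ≡ suc (count X S)
  count-∈ X S x∈S = cong length (filter-accept (λ x → member? _≟ᶠ_ x (keys S)) x∈S)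

  count-∉ : ∀ {x : Fin n} X S → x ∉ˡ keys S → count (x ∷ X) S ≡ count X S
  count-∉ X S x∉S = cong length (filter-reject (λ x → member? _≟ᶠ_ x (keys S)) x∉S)

count-tail : ∀ (x : Fin n) X S → count X S ≤ count (x ∷ X) S
count-tail x X S with member? _≟ᶠ_ x (keys S)
... | yes x∈ = ≤-trans (n≤1+n _) (≤-reflexive (sym (count-∈ X S x∈)))
... | no x∉  = ≤-reflexive (sym (count-∉ X S x∉))

-- A run of the cyclic automaton `next` on the queries. It turns a condition on consecutive queries
-- into a state carried along `X`; a run from `p` back to `p` is a pattern that closes up.
data Follows {n : ℕ} {Phase : Set} (next : Phase → Phase) (S : Phase → BinTree n) :
             Phase → List (Fin n) → Phase → Set where
  []   : ∀ {p} → Follows next S p [] p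
  skip : ∀ {p q x X} → (∀ a → x ∉ˡ keys (S a)) → Follows next S p X q → Follows next S p (x ∷ X) q
  take : ∀ {p q x X} → x ∈ˡ keys (S p) → Follows next S (next p) X q → Follows next S p (x ∷ X) q

Disjoint : {Phase : Set} → (Phase → BinTree n) → Set
Disjoint S = ∀ {p q x} → x ∈ˡ keys (S p) → x ∈ˡ keys (S q) → p ≡ q

module _ {Phase : Set} (next : Phase → Phase) (S : Phase → BinTree n) (disj : Disjoint S)
         (P : BinTree n) (S⊆P : ∀ p {x} → x ∈ˡ keys (S p) → x ∈ˡ keys P) where

  private
    R : Fin n → Fin n → Set
    R x y = ∃ λ p → x ∈ˡ keys (S p) × y ∈ˡ keys (S (next p))

  -- The query `y` after `X` identifies the phase in which `X` ends.
  follow : ∀ X {p x y ys} → x ∈ˡ keys (S p) → Linked R (x ∷ (X ∣ᵗ P) ++ y ∷ ys) →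
           ∃ λ q → Follows next S (next p) X q × y ∈ˡ keys (S q)
  follow [] x∈p ((p′ , x∈p′ , y∈) ∷ _) with refl ← disj x∈p x∈p′ = _ , [] , y∈
  follow (x′ ∷ X) x∈p c with member? _≟ᶠ_ x′ (keys P)
  ... | no x′∉ = let q , f , y∈q = follow X x∈p c in q , skip (λ a → x′∉ ∘ S⊆P a) f , y∈q
  follow (x′ ∷ X) x∈p ((p′ , x∈p′ , x′∈) ∷ c) | yes _ with refl ← disj x∈p x∈p′ =
    let q , f , y∈q = follow X x′∈ c in q , take x′∈ f , y∈q

  follow-none : ∀ X {p} → X ∣ᵗ P ≡ [] → Follows next S p X p
  follow-none []      _ = []
  follow-none (x ∷ X) e with member? _≟ᶠ_ x (keys P)
  ... | no x∉ = skip (λ a → x∉ ∘ S⊆P a) (follow-none X e)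

  phase-of : ∀ {x y} xs {ys} → Linked R (x ∷ xs ++ y ∷ ys) → ∃ λ p → x ∈ˡ keys (S p)
  phase-of []      ((p , x∈p , _) ∷ _) = p , x∈p
  phase-of (_ ∷ _) ((p , x∈p , _) ∷ _) = p , x∈p

  follow-all : ∀ X {x xs y ys} → X ∣ᵗ P ≡ x ∷ xs → Linked R (x ∷ xs ++ y ∷ ys) →
               ∃₂ λ p q → Follows next S p X q × x ∈ˡ keys (S p) × y ∈ˡ keys (S q)
  follow-all (x′ ∷ X) e c with member? _≟ᶠ_ x′ (keys P)
  ... | no x′∉ = let p , q , f , r = follow-all X e c in p , q , skip (λ a → x′∉ ∘ S⊆P a) f , r
  follow-all (x′ ∷ X) refl c | yes _ =
    let p , x∈p = phase-of (X ∣ᵗ P) c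
        q , f , y∈q = follow X x∈p c
    in p , q , take x∈p f , x∈p , y∈q

  -- The second copy of `X` begins with the same relevant query `x` as the first. It is accepted in
  -- the start phase `p` and in the phase `q` reached after the first copy, so disjointness forces
  -- `p` and `q` to agree.
  follow-cycle : Phase → ∀ X → Linked R ((X ++ X) ∣ᵗ P) → ∃ λ p → Follows next S p X p
  follow-cycle p₀ X c with X ∣ᵗ P in eq | subst (Linked R) (filter-++ (λ x → member? _≟ᶠ_ x (keys P)) X X) c
  -- No query of `X` concerns `P`, so any phase will do.
  ... | []     | _  = p₀ , follow-none X eq
  ... | x ∷ xs | c′ with follow-all X eq c′
  ... | p , q , f , x∈p , x∈q with refl ← disj {p} {q} x∈p x∈q = p , f

module _ {S : Bool → BinTree n} (disj : Disjoint S) where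

  private
    ∉-other : ∀ b {x} → x ∈ˡ keys (S b) → x ∉ˡ keys (S (not b))
    ∉-other b x∈ x∈′ = not-¬ refl (disj {b} x∈ x∈′)

    count-take : ∀ b {x} X → x ∈ˡ keys (S b) → count (x ∷ X) (S b) ≡ suc (count X (S b)) ×
                 count (x ∷ X) (S (not b)) ≡ count X (S (not b))
    count-take b X x∈ = count-∈ X (S b) x∈ , count-∉ X (S (not b)) (∉-other b x∈)

  -- Each query taken swaps the roles of the two sides. The starting side is ahead by one exactly
  -- when an odd number of queries is taken, that is, when `p` and `q` differ.
  alternating-count : ∀ {p X q} → Follows not S p X q →
                      count X (S p) ≡ bit (p xor q) + count X (S (not p))
  alternating-count {false} [] rewrite count-[] (S false) | count-[] (S true) = refl
  alternating-count {true}  [] rewrite count-[] (S false) | count-[] (S true) = refl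
  alternating-count {p} (skip {X = X} x∉ f)
    rewrite count-∉ X (S p) (x∉ p) | count-∉ X (S (not p)) (x∉ (not p)) = alternating-count f
  alternating-count {false} {q = false} (take {X = X} x∈ f)
    rewrite proj₁ (count-take false X x∈) | proj₂ (count-take false X x∈) = sym (alternating-count f)
  alternating-count {false} {q = true}  (take {X = X} x∈ f)
    rewrite proj₁ (count-take false X x∈) | proj₂ (count-take false X x∈) = cong suc (sym (alternating-count f))
  alternating-count {true}  {q = false} (take {X = X} x∈ f)
    rewrite proj₁ (count-take true X x∈) | proj₂ (count-take true X x∈) = cong suc (sym (alternating-count f))
  alternating-count {true}  {q = true}  (take {X = X} x∈ f)
    rewrite proj₁ (count-take true X x∈) | proj₂ (count-take true X x∈) = sym (alternating-count f)

  alternating-least : ∀ {p X q} → Follows not S p X q → ∀ b → count X (S (not p)) ≤ count X (S b)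
  alternating-least {p} f b with b ≟ not p
  ... | yes refl = ≤-refl
  ... | no b≢ rewrite ¬-not b≢ | not-involutive p | alternating-count f = m≤n+m _ _

  alternating-close : ∀ {p X q} → Follows not S p X q → ∀ b c → count X (S b) ≤ suc (count X (S c))
  alternating-close {p} {X} {q} f b c = ≤-trans (most b) (s≤s (alternating-least f c))
    where
    bit≤1 : ∀ b → bit b ≤ 1
    bit≤1 false = z≤n
    bit≤1 true  = ≤-refl
    most : ∀ b → count X (S b) ≤ suc (count X (S (not p)))
    most b with b ≟ not p
    ... | yes refl = n≤1+n _
    ... | no b≢ rewrite ¬-not b≢ | not-involutive p | alternating-count f = +-monoˡ-≤ _ (bit≤1 (p xor q))

  alternating-cycle : ∀ {p X} → Follows not S p X p → count X (S false) ≡ count X (S true)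
  alternating-cycle {false} f = alternating-count f
  alternating-cycle {true}  f = sym (alternating-count f)

  -- If the transition point is untouched it stays on its side, and then
  -- the next query to that side touches it.

  alternating-touches : ∀ {z} → Monotone z → (∀ b {x} → x ∈ˡ keys (S b) → z x ≡ zoneOf b) →
                        ∀ {T p X q} → Ordered 0 n T → (run : Run T X) → Follows not S p X q →
                        count X (S (side z T)) ≤ touches z run
  alternating-touches {z} mono zones {T} o done [] = ≤-reflexive (count-[] (S (side z T)))
  alternating-touches {z} mono zones {T} o (serve {T′ = T′} {x} {X} σ U m run) = step
    where
    s = side z T
    t = touch z (pathSet x T ∪ U) T

    IH : ∀ {p q} → Follows not S p X q → count X (S (side z T′)) ≤ touches z run
    IH = alternating-touches mono zones (rotations-ordered σ o) run

    covered : Covers (pathSet x T ∪ U) (rotatedEdges σ)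
    covered = All.map (λ (p , q) → x∈p∪q⁺ (inj₂ p) , x∈p∪q⁺ (inj₂ q)) (IsMinimalSubtree.covers m)

    carry : ∀ {p q} → Follows not S p X q → count X (S s) ≤ t + touches z run
    carry f with t in eq
    -- A touched transition point may change sides. The counts of the two sides differ by at most
    -- one, and the touch pays for that.
    ... | suc t′ = ≤-trans (alternating-close f s (side z T′)) (s≤s (≤-trans (IH f) (m≤n+m _ t′)))
    ... | zero rewrite untouched⇒side mono σ o covered eq = IH f

    step : ∀ {p q} → Follows not S p (x ∷ X) q → count (x ∷ X) (S s) ≤ t + touches z run
    step (skip x∉ f) = ≤-trans (≤-reflexive (count-∉ X (S s) (x∉ s))) (carry f)
    step (take {p = p} x∈ f) with s ≟ p
    ... | no s≢p = subst (λ b → count (x ∷ X) (S b) ≤ t + touches z run) (sym (¬-not s≢p))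
      (≤-trans (≤-reflexive (proj₂ (count-take p X x∈)))
        (subst (λ b → count X (S b) ≤ t + touches z run) (¬-not s≢p) (carry f)))
    ... | yes s≡p = begin
      count (x ∷ X) (S s)               ≡⟨ cong (count (x ∷ X) ∘ S) s≡p ⟩
      count (x ∷ X) (S p)               ≡⟨ count-∈ X (S p) x∈ ⟩
      suc (count X (S p))               ≡⟨ cong (suc ∘ count X ∘ S) (not-involutive p) ⟨
      -- The touch already pays for `x`, so a change of sides has to be free. It is, because the
      -- phase after `x` is `not p`, and then `S p` has the fewest remaining queries.
      suc (count X (S (not (not p))))   ≤⟨ s≤s (alternating-least f (side z T′)) ⟩
      suc (count X (S (side z T′)))     ≤⟨ s≤s (IH f) ⟩
      1 + touches z run                 ≡⟨ cong (_+ touches z run) forced ⟨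
      t + touches z run                 ∎
      where
      open ≤-Reasoning
      forced : t ≡ 1
      forced = touch-forced mono o z≤n (toℕ<n x) (path⊆touched {x = x} {T = T} U)
                 (trans (zones p x∈) (cong zoneOf (sym s≡p)))

pair : BinTree n → BinTree n → Bool → BinTree n
pair A B false = A
pair A B true  = B

pair-disjoint : ∀ {A B : BinTree n} → (∀ {x} → x ∈ˡ keys A → x ∉ˡ keys B) → Disjoint (pair A B)
pair-disjoint d {false} {false} p q = refl
pair-disjoint d {false} {true}  p q = contradiction q (d p)
pair-disjoint d {true}  {false} p q = contradiction p (d q)
pair-disjoint d {true}  {true}  p q = refl

-- Since the pattern closes up, both sides are queried equally often, and the bound holds whichever
-- side the transition point starts on.
pair-touches : ∀ {A B : BinTree n} {z} → Monotone z →
               (∀ {x} → x ∈ˡ keys A → z x ≡ first) → (∀ {x} → x ∈ˡ keys B → z x ≡ second) →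
               ∀ {T X p} → Ordered 0 n T → (run : Run T X) → Follows not (pair A B) p X p →
               count X A ≡ count X B × count X A ≤ touches z run
pair-touches {A = A} {B} {z} mono fst snd {T} {X} o run f =
  A≡B , subst (_≤ touches z run) (side-count (side z T)) (alternating-touches disjoint mono zones o run f)
  where
  zones : ∀ b {x} → x ∈ˡ keys (pair A B b) → z x ≡ zoneOf b
  zones false = fst
  zones true  = snd

  disjoint = pair-disjoint λ p q → contradiction (trans (sym (fst p)) (snd q)) λ ()
  A≡B = alternating-cycle disjoint f

  side-count : ∀ b → count X (pair A B b) ≡ count X A
  side-count false = refl
  side-count true  = sym A≡B

-- Used for a weakly-stable pattern a, b, r: it alternates between a and b,
-- and it alternates between b and r.

project : ∀ {Phase : Set} {next : Phase → Phase} {S S′} (π : Phase → Bool) →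
          (∀ {x : Fin n} → (∀ p → x ∉ˡ keys (S p)) → ∀ b → x ∉ˡ keys (S′ b)) →
          (∀ p {x} → x ∈ˡ keys (S p) →
             (x ∈ˡ keys (S′ (π p)) × π (next p) ≡ not (π p)) ⊎
             ((∀ b → x ∉ˡ keys (S′ b)) × π (next p) ≡ π p)) →
          ∀ {p X q} → Follows next S p X q → Follows not S′ (π p) X (π q)
project π out keep []         = []
project π out keep (skip x∉ f) = skip (out x∉) (project π out keep f)
project {S′ = S′} π out keep (take {p = p} {q} {X = X} x∈ f) with keep p x∈ | project π out keep f
... | inj₁ (x∈′ , e) | f′ = take x∈′ (subst (λ b → Follows not S′ b X (π q)) e f′)
... | inj₂ (x∉ , e)  | f′ = skip x∉ (subst (λ b → Follows not S′ b X (π q)) e f′)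

count-node : ∀ {l r : BinTree n} {v} X → All (_≢ v) X → count X (node l v r) ≤ count X l + count X r
count-node {l = l} {r} {v} [] [] rewrite count-[] (node l v r) = z≤n
count-node {l = l} {r} {v} (x ∷ X) (x≢v ∷ X≢v) with member? _≟ᶠ_ x (keys (node l v r))
... | no x∉
  rewrite count-∉ X (node l v r) x∉ | count-∉ X l (x∉ ∘ ∈-left {l = l} {r}) | count-∉ X r (x∉ ∘ ∈-right {l = l} {r})
  = count-node X X≢v
... | yes x∈ rewrite count-∈ X (node l v r) x∈ with ∈-node⁻ {l = l} {r} x∈
...   | inj₁ x∈l rewrite count-∈ X l x∈l = s≤s (≤-trans (count-node X X≢v) (+-monoʳ-≤ (count X l) (count-tail x X r)))
...   | inj₂ (inj₁ x≡v) = contradiction x≡v x≢v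
...   | inj₂ (inj₂ x∈r) rewrite count-∈ X r x∈r | +-suc (count (x ∷ X) l) (count X r) =
  s≤s (≤-trans (count-node X X≢v) (+-monoˡ-≤ (count X r) (count-tail x X l)))

≼⇒∈ : ∀ {l r T : BinTree n} {v} → node l v r ≼ T → v ∈ˡ keys T
≼⇒∈ {l = l} {r} here = ∈-root {l = l} {r}
≼⇒∈ (left {l} {r = r} p)  = ∈-left {l = l} {r} (≼⇒∈ p)
≼⇒∈ (right {l} {r = r} p) = ∈-right {l = l} {r} (≼⇒∈ p)

≼-unique : ∀ {a b c d T : BinTree n} {v} → Ordered lo hi T →
           node a v b ≼ T → node c v d ≼ T → node a v b ≡ node c v d
≼-unique o            here      here      = refl
≼-unique (node oˡ oʳ) here      (left q)  = contradiction (proj₂ (∈⇒range oˡ (≼⇒∈ q))) (<-irrefl refl)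
≼-unique (node oˡ oʳ) here      (right q) = contradiction (proj₁ (∈⇒range oʳ (≼⇒∈ q))) (<-irrefl refl)
≼-unique (node oˡ oʳ) (left p)  here      = contradiction (proj₂ (∈⇒range oˡ (≼⇒∈ p))) (<-irrefl refl)
≼-unique (node oˡ oʳ) (right p) here      = contradiction (proj₁ (∈⇒range oʳ (≼⇒∈ p))) (<-irrefl refl)
≼-unique (node oˡ oʳ) (left p)  (left q)  = ≼-unique oˡ p q
≼-unique (node oˡ oʳ) (right p) (right q) = ≼-unique oʳ p q
≼-unique (node oˡ oʳ) (left p)  (right q) =
  contradiction (<-trans (proj₂ (∈⇒range oˡ (≼⇒∈ p))) (proj₁ (∈⇒range oʳ (≼⇒∈ q)))) (<-irrefl refl)
≼-unique (node oˡ oʳ) (right p) (left q)  =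
  contradiction (<-trans (proj₂ (∈⇒range oˡ (≼⇒∈ q))) (proj₁ (∈⇒range oʳ (≼⇒∈ p)))) (<-irrefl refl)

-- A key occurs at one node of an ordered tree only, and that node cannot be both inner and a leaf.
inner≢leafKey : ∀ {T l r : BinTree n} {v x} → Ordered lo hi T → Inner (node l v r) → node l v r ≼ T →
                LeafKey T x → x ≢ v
inner≢leafKey o inner p q refl with () ← ≼-unique o p q

≼-left : ∀ {l r T : BinTree n} {v} → node l v r ≼ T → l ≼ T
≼-left here      = left here
≼-left (left p)  = left (≼-left p)
≼-left (right p) = right (≼-left p)

≼-right : ∀ {l r T : BinTree n} {v} → node l v r ≼ T → r ≼ T
≼-right here      = right here
≼-right (left p)  = left (≼-right p)
≼-right (right p) = right (≼-right p)

Full⇒Inner : ∀ {l r : BinTree n} {v} → Full l → Full r → Inner (node l v r)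
Full⇒Inner single     single     = inner
Full⇒Inner single     (node _ _) = inner
Full⇒Inner (node _ _) single     = inner
Full⇒Inner (node _ _) (node _ _) = inner

-- Recursion on fullness stops at leaves in the usual sense rather than at empty trees, so that only
-- inner nodes are counted.
innerQueries : {P : BinTree n} → Full P → List (Fin n) → ℕ
innerQueries single X = 0
innerQueries (node {l} {v} {r} fˡ fʳ) X = count X (node l v r) + (innerQueries fˡ X + innerQueries fʳ X)

-- Touches at strongly-stable and weakly-stable nodes

data Phase : Set where
  α β γ : Phase

next : Phase → Phase
next α = β
next β = γ
next γ = α

triple : (A B C : BinTree n) → Phase → BinTree n
triple A B C α = A
triple A B C β = B
triple A B C γ = C

triple-disjoint : ∀ {A B C : BinTree n} → (∀ {x} → x ∈ˡ keys A → x ∉ˡ keys B) →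
                  (∀ {x} → x ∈ˡ keys A → x ∉ˡ keys C) → (∀ {x} → x ∈ˡ keys B → x ∉ˡ keys C) →
                  Disjoint (triple A B C)
triple-disjoint ab ac bc {α} {α} p q = refl
triple-disjoint ab ac bc {α} {β} p q = contradiction q (ab p)
triple-disjoint ab ac bc {α} {γ} p q = contradiction q (ac p)
triple-disjoint ab ac bc {β} {α} p q = contradiction p (ab q)
triple-disjoint ab ac bc {β} {β} p q = refl
triple-disjoint ab ac bc {β} {γ} p q = contradiction q (bc p)
triple-disjoint ab ac bc {γ} {α} p q = contradiction p (ac q)
triple-disjoint ab ac bc {γ} {β} p q = contradiction p (bc q)
triple-disjoint ab ac bc {γ} {γ} p q = refl

ordered-disjoint : ∀ {A B : BinTree n} {lo mid mid′ hi} → Ordered lo mid A → Ordered mid′ hi B → mid ≤ mid′ →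
                   ∀ {x} → x ∈ˡ keys A → x ∉ˡ keys B
ordered-disjoint oA oB m≤m′ p q = <⇒≱ (proj₂ (∈⇒range oA p)) (≤-trans m≤m′ (proj₁ (∈⇒range oB q)))

-- `A` may fill just a part of the interval, as a grandchild of a weakly-stable node does.
zone-left : ∀ {A : BinTree n} {v lo lo′ hi′} hi → Ordered lo′ hi′ A → lo ≤ lo′ → hi′ ≤ v →
            ∀ {x} → x ∈ˡ keys A → zone lo (suc v) hi x ≡ first
zone-left hi oA lo≤ ≤v x∈ =
  let p , q = ∈⇒range oA x∈ in zone-first {hi = hi} (≤-trans lo≤ p) (m≤n⇒m≤1+n (≤-trans q ≤v))

zone-right : ∀ {A : BinTree n} {v lo hi lo′ hi′} → Ordered lo′ hi′ A → lo ≤ v → v < lo′ → hi′ ≤ hi →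
             ∀ {x} → x ∈ˡ keys A → zone lo (suc v) hi x ≡ second
zone-right oA lo≤v v<lo′ ≤hi x∈ =
  let p , q = ∈⇒range oA x∈ in zone-second (m≤n⇒m≤1+n lo≤v) (≤-trans v<lo′ p) (<-≤-trans q ≤hi)

module _ {T : BinTree n} {X : List (Fin n)} (run : Run T X) (ordered : Ordered 0 n T) where

  strong-touches : ∀ {l v r} → Ordered lo hi (node l v r) →
    Linked (λ x y → Step l r x y ⊎ Step r l x y) ((X ++ X) ∣ᵗ node l v r) →
    count X l ≡ count X r × count X l ≤ touches (zone lo (suc (toℕ v)) hi) run
  strong-touches {lo = lo} {hi} {l} {v} {r} (node oˡ oʳ) c =
    pair-touches (zone-mono lo (suc (toℕ v)) hi) (zone-left hi oˡ ≤-refl ≤-refl)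
      (zone-right oʳ (Ordered⇒≤ oˡ) ≤-refl ≤-refl) ordered run (proj₂ cycle)
    where
    sub : ∀ b {x} → x ∈ˡ keys (pair l r b) → x ∈ˡ keys (node l v r)
    sub false = ∈-left {l = l} {r}
    sub true  = ∈-right {l = l} {r}
    cycle = follow-cycle not (pair l r) (pair-disjoint (ordered-disjoint oˡ oʳ (n≤1+n _))) (node l v r) sub false X
      (Linked.map (λ { (inj₁ s) → false , s ; (inj₂ s) → true , s }) c)

  -- At `u` the queries to `r` are skipped, and those to `a` and `b` alternate. At `v` the subtree
  -- `b` alone represents the left side: the queries to `a` are skipped, and those to `b` and `r`
  -- alternate.
  weakˡ-touches : ∀ {a u b v r} → Ordered lo hi (node (node a u b) v r) →
    Linked (λ x y → Step a b x y ⊎ Step b r x y ⊎ Step r a x y) ((X ++ X) ∣ᵗ node (node a u b) v r) →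
    (count X a ≡ count X b × count X a ≤ touches (zone lo (suc (toℕ u)) (toℕ v)) run) ×
    (count X b ≡ count X r × count X b ≤ touches (zone lo (suc (toℕ v)) hi) run)
  weakˡ-touches {lo = lo} {hi} {a} {u} {b} {v} {r} (node (node oᵃ oᵇ) oʳ) c =
    pair-touches (zone-mono lo (suc (toℕ u)) (toℕ v)) (zone-left (toℕ v) oᵃ ≤-refl ≤-refl)
      (zone-right oᵇ lo≤u ≤-refl ≤-refl) ordered run
      (project πᵘ (λ x∉ → λ { false → x∉ α ; true → x∉ β })
        (λ { α x∈ → inj₁ (x∈ , refl)
           ; β x∈ → inj₁ (x∈ , refl)
           ; γ x∈ → inj₂ ((λ { false p → a⊥r p x∈ ; true p → b⊥r p x∈ }) , refl) }) (proj₂ cycle)) ,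
    pair-touches (zone-mono lo (suc (toℕ v)) hi) (zone-left hi oᵇ (m≤n⇒m≤1+n lo≤u) ≤-refl)
      (zone-right oʳ (≤-trans lo≤u (<⇒≤ u<v)) ≤-refl ≤-refl) ordered run
      (project πᵛ (λ x∉ → λ { false → x∉ β ; true → x∉ γ })
        (λ { α x∈ → inj₂ ((λ { false p → a⊥b x∈ p ; true p → a⊥r x∈ p }) , refl)
           ; β x∈ → inj₁ (x∈ , refl)
           ; γ x∈ → inj₁ (x∈ , refl) }) (proj₂ cycle))
    where
    lo≤u = Ordered⇒≤ oᵃ
    u<v  = Ordered⇒≤ oᵇ
    a⊥b = ordered-disjoint oᵃ oᵇ (n≤1+n _)
    a⊥r = ordered-disjoint oᵃ oʳ (<⇒≤ (m≤n⇒m≤1+n u<v))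
    b⊥r = ordered-disjoint oᵇ oʳ (n≤1+n _)
    -- A skipped query must not change the Boolean phase, so the phase that is skipped takes the
    -- value of the phase after it.
    πᵘ πᵛ : Phase → Bool
    πᵘ α = false
    πᵘ β = true
    πᵘ γ = false
    πᵛ α = false
    πᵛ β = false
    πᵛ γ = true
    sub : ∀ p {x} → x ∈ˡ keys (triple a b r p) → x ∈ˡ keys (node (node a u b) v r)
    sub α = ∈-left {l = node a u b} {r} ∘ ∈-left {l = a} {b}
    sub β = ∈-left {l = node a u b} {r} ∘ ∈-right {l = a} {b}
    sub γ = ∈-right {l = node a u b} {r}
    cycle = follow-cycle next (triple a b r) (triple-disjoint a⊥b a⊥r b⊥r) (node (node a u b) v r) sub α X
      (Linked.map (λ { (inj₁ s) → α , s ; (inj₂ (inj₁ s)) → β , s ; (inj₂ (inj₂ s)) → γ , s }) c)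

  weakʳ-touches : ∀ {l v a u b} → Ordered lo hi (node l v (node a u b)) →
    Linked (λ x y → Step b a x y ⊎ Step a l x y ⊎ Step l b x y) ((X ++ X) ∣ᵗ node l v (node a u b)) →
    (count X a ≡ count X b × count X a ≤ touches (zone (suc (toℕ v)) (suc (toℕ u)) hi) run) ×
    (count X l ≡ count X a × count X l ≤ touches (zone lo (suc (toℕ v)) hi) run)
  weakʳ-touches {lo = lo} {hi} {l} {v} {a} {u} {b} (node oˡ (node oᵃ oᵇ)) c =
    pair-touches (zone-mono (suc (toℕ v)) (suc (toℕ u)) hi) (zone-left hi oᵃ ≤-refl ≤-refl)
      (zone-right oᵇ v<u ≤-refl ≤-refl) ordered run
      (project πᵘ (λ x∉ → λ { false → x∉ β ; true → x∉ α })
        (λ { α x∈ → inj₁ (x∈ , refl)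
           ; β x∈ → inj₁ (x∈ , refl)
           ; γ x∈ → inj₂ ((λ { false p → l⊥a x∈ p ; true p → l⊥b x∈ p }) , refl) }) (proj₂ cycle)) ,
    pair-touches (zone-mono lo (suc (toℕ v)) hi) (zone-left hi oˡ ≤-refl ≤-refl)
      (zone-right oᵃ (Ordered⇒≤ oˡ) ≤-refl (<⇒≤ u<hi)) ordered run
      (project πᵛ (λ x∉ → λ { false → x∉ γ ; true → x∉ β })
        (λ { α x∈ → inj₂ ((λ { false p → l⊥b p x∈ ; true p → a⊥b p x∈ }) , refl)
           ; β x∈ → inj₁ (x∈ , refl)
           ; γ x∈ → inj₁ (x∈ , refl) }) (proj₂ cycle))
    where
    v<u  = Ordered⇒≤ oᵃ
    u<hi = Ordered⇒≤ oᵇ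
    a⊥b = ordered-disjoint oᵃ oᵇ (n≤1+n _)
    l⊥a = ordered-disjoint oˡ oᵃ (n≤1+n _)
    l⊥b = ordered-disjoint oˡ oᵇ (<⇒≤ (m≤n⇒m≤1+n v<u))
    -- The phases follow the pattern `b`, `a`, `l`, whereas the pairs are in key order; hence all
    -- values are opposite to those for the left bias.
    πᵘ πᵛ : Phase → Bool
    πᵘ α = true
    πᵘ β = false
    πᵘ γ = true
    πᵛ α = true
    πᵛ β = true
    πᵛ γ = false
    sub : ∀ p {x} → x ∈ˡ keys (triple b a l p) → x ∈ˡ keys (node l v (node a u b))
    sub α = ∈-right {l = l} {node a u b} ∘ ∈-right {l = a} {b}
    sub β = ∈-right {l = l} {node a u b} ∘ ∈-left {l = a} {b}
    sub γ = ∈-left {l = l} {node a u b}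
    cycle = follow-cycle next (triple b a l)
      (triple-disjoint (λ p q → a⊥b q p) (λ p q → l⊥b q p) (λ p q → l⊥a q p)) (node l v (node a u b)) sub α X
      (Linked.map (λ { (inj₁ s) → α , s ; (inj₂ (inj₁ s)) → β , s ; (inj₂ (inj₂ s)) → γ , s }) c)

-- At a weakly-stable v with favored child u the three grandparts are
-- queried equally often, say k times: 5k queries pass v and u, which
-- account for 2k touches.

favored-count : ∀ {v u a b r tᵛ tᵘ} → v ≤ u + r → u ≤ a + b → a ≡ b × a ≤ tᵘ → b ≡ r × b ≤ tᵛ →
                2 * (v + u) ≤ 5 * (tᵛ + tᵘ)
favored-count {v} {u} {a} {tᵛ = tᵛ} {tᵘ} v≤ u≤ (refl , a≤tᵘ) (refl , a≤tᵛ) = begin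
  2 * (v + u)                 ≤⟨ *-monoʳ-≤ 2 (+-mono-≤ (≤-trans v≤ (+-monoˡ-≤ a u≤)) u≤) ⟩
  2 * (a + a + a + (a + a))   ≡⟨ solve 1 (λ a → con 2 :* (a :+ a :+ a :+ (a :+ a)) := con 5 :* (a :+ a)) refl a ⟩
  5 * (a + a)                 ≤⟨ *-monoʳ-≤ 5 (+-mono-≤ a≤tᵛ a≤tᵘ) ⟩
  5 * (tᵛ + tᵘ)               ∎
  where
  open ≤-Reasoning
  open +-*-Solver

module _ {T : BinTree n} {X : List (Fin n)} (run : Run T X) (ordered : Ordered 0 n T)
         {κ : Fin n → Kind} (stable : StableAs κ T (X ++ X)) where

  private
    inner∉queries : ∀ {l v r} → Inner (node l v r) → node l v r ≼ T → All (_≢ v) X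
    inner∉queries i p =
      All.map (inner≢leafKey ordered i p) (++⁻ˡ X (StableAs.leafQueries stable))

  strong-count : ∀ {l v r} → Ordered lo hi (node l v r) → node l v r ≼ T → Inner (node l v r) →
                 Linked (λ x y → Step l r x y ⊎ Step r l x y) ((X ++ X) ∣ᵗ node l v r) →
                 count X (node l v r) ≤ 2 * touches (zone lo (suc (toℕ v)) hi) run
  strong-count {lo = lo} {hi} {l} {v} {r} o p i c = begin
    count X (node l v r)    ≤⟨ count-node X (inner∉queries i p) ⟩
    count X l + count X r   ≡⟨ cong (count X l +_) l≡r ⟨
    count X l + count X l   ≤⟨ +-mono-≤ l≤t l≤t ⟩
    t + t                   ≡⟨ cong (t +_) (+-identityʳ t) ⟨
    2 * t                   ∎
    where
    open ≤-Reasoning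
    t = touches (zone lo (suc (toℕ v)) hi) run
    bounds = strong-touches run ordered o c
    l≡r = proj₁ bounds
    l≤t = proj₂ bounds

  strong-bound : κ ≗ const strong → ∀ {lo hi P} (f : Full P) → P ≼ T → Ordered lo hi P →
                 innerQueries f X ≤ 2 * allTouches lo hi P run
  strong-bound all-strong single p o = z≤n
  strong-bound all-strong {lo} {hi} (node {l} {v} {r} fˡ fʳ) p o@(node oˡ oʳ)
    -- Once the kind is `strong`, `alternating` is the only possible constructor.
    with subst (λ k → StableNode ((X ++ X) ∣ᵗ node l v r) k (node l v r)) (all-strong v) (StableAs.stableNodes stable p (Full⇒Inner fˡ fʳ))
  ... | alternating c = begin
    count X (node l v r) + (innerQueries fˡ X + innerQueries fʳ X)
      ≤⟨ +-mono-≤ (strong-count o p (Full⇒Inner fˡ fʳ) c)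
           (+-mono-≤ (strong-bound all-strong fˡ (≼-left p) oˡ) (strong-bound all-strong fʳ (≼-right p) oʳ)) ⟩
    2 * t + (2 * tˡ + 2 * tʳ)
      ≡⟨ solve 3 (λ t a b → con 2 :* t :+ (con 2 :* a :+ con 2 :* b) := con 2 :* (t :+ (a :+ b))) refl t tˡ tʳ ⟩
    2 * (t + (tˡ + tʳ)) ∎
    where
    open ≤-Reasoning
    open +-*-Solver
    t  = touches (zone lo (suc (toℕ v)) hi) run
    tˡ = allTouches lo (toℕ v) l run
    tʳ = allTouches (suc (toℕ v)) hi r run

  mixed-bound : ∀ {lo hi P} (f : Full P) → P ≼ T → Ordered lo hi P →
                2 * innerQueries f X ≤ 5 * allTouches lo hi P run

  -- Stated for a variable kind `k`, since matching on the stability proof cannot unify `κ v` with a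
  -- constructor. In the biased cases the favored child is charged together with `v`, and the
  -- recursion resumes at the subtrees of that child.
  mixed-node : ∀ {lo hi l v r k} (fˡ : Full l) (fʳ : Full r) → node l v r ≼ T → Ordered lo hi (node l v r) →
               StableNode ((X ++ X) ∣ᵗ node l v r) k (node l v r) →
               2 * innerQueries (node {v = v} fˡ fʳ) X ≤ 5 * allTouches lo hi (node l v r) run

  mixed-bound single        p o = z≤n
  mixed-bound (node fˡ fʳ) p o = mixed-node fˡ fʳ p o (StableAs.stableNodes stable p (Full⇒Inner fˡ fʳ))

  mixed-node {lo} {hi} {l} {v} {r} fˡ fʳ p o@(node oˡ oʳ) (alternating c) = begin
    2 * (count X (node l v r) + (gˡ + gʳ))
      ≤⟨ *-monoʳ-≤ 2 (+-monoˡ-≤ (gˡ + gʳ) (strong-count o p (Full⇒Inner fˡ fʳ) c)) ⟩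
    2 * (2 * t + (gˡ + gʳ))
      ≡⟨ solve 3 (λ t a b → con 2 :* (con 2 :* t :+ (a :+ b)) := con 4 :* t :+ (con 2 :* a :+ con 2 :* b)) refl t gˡ gʳ ⟩
    4 * t + (2 * gˡ + 2 * gʳ)
      -- A strongly-stable node has ratio 2, which leaves one spare `t` for the ratio 5/2.
      ≤⟨ +-mono-≤ (*-monoˡ-≤ t (n≤1+n 4)) (+-mono-≤ (mixed-bound fˡ (≼-left p) oˡ) (mixed-bound fʳ (≼-right p) oʳ)) ⟩
    5 * t + (5 * tˡ + 5 * tʳ)
      ≡⟨ solve 3 (λ t a b → con 5 :* t :+ (con 5 :* a :+ con 5 :* b) := con 5 :* (t :+ (a :+ b))) refl t tˡ tʳ ⟩
    5 * (t + (tˡ + tʳ)) ∎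
    where
    open ≤-Reasoning
    open +-*-Solver
    gˡ = innerQueries fˡ X
    gʳ = innerQueries fʳ X
    t  = touches (zone lo (suc (toℕ v)) hi) run
    tˡ = allTouches lo (toℕ v) l run
    tʳ = allTouches (suc (toℕ v)) hi r run
  mixed-node {lo} {hi} {_} {v} {r} (node {a} {u} {b} fᵃ fᵇ) fʳ p o@(node (node oᵃ oᵇ) oʳ) (leftBias i c) = begin
    2 * (cᵛ + ((cᵘ + (gᵃ + gᵇ)) + gʳ))
      ≡⟨ solve 5 (λ v u a b r → con 2 :* (v :+ ((u :+ (a :+ b)) :+ r)) :=
                                con 2 :* (v :+ u) :+ (con 2 :* a :+ con 2 :* b :+ con 2 :* r)) refl cᵛ cᵘ gᵃ gᵇ gʳ ⟩
    2 * (cᵛ + cᵘ) + (2 * gᵃ + 2 * gᵇ + 2 * gʳ)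
      ≤⟨ +-mono-≤ (favored-count (count-node X (inner∉queries (Full⇒Inner (node fᵃ fᵇ) fʳ) p))
                                 (count-node X (inner∉queries i (≼-left p)))
                                 (proj₁ bounds) (proj₂ bounds))
           (+-mono-≤ (+-mono-≤ (mixed-bound fᵃ (≼-left (≼-left p)) oᵃ) (mixed-bound fᵇ (≼-right (≼-left p)) oᵇ))
                     (mixed-bound fʳ (≼-right p) oʳ)) ⟩
    5 * (tᵛ + tᵘ) + (5 * tᵃ + 5 * tᵇ + 5 * tʳ)
      ≡⟨ solve 5 (λ v u a b r → con 5 :* (v :+ u) :+ (con 5 :* a :+ con 5 :* b :+ con 5 :* r) :=
                                con 5 :* (v :+ ((u :+ (a :+ b)) :+ r))) refl tᵛ tᵘ tᵃ tᵇ tʳ ⟩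
    5 * (tᵛ + ((tᵘ + (tᵃ + tᵇ)) + tʳ)) ∎
    where
    open ≤-Reasoning
    open +-*-Solver
    bounds = weakˡ-touches run ordered o c
    cᵛ = count X (node (node a u b) v r)
    cᵘ = count X (node a u b)
    gᵃ = innerQueries fᵃ X
    gᵇ = innerQueries fᵇ X
    gʳ = innerQueries fʳ X
    tᵛ = touches (zone lo (suc (toℕ v)) hi) run
    tᵘ = touches (zone lo (suc (toℕ u)) (toℕ v)) run
    tᵃ = allTouches lo (toℕ u) a run
    tᵇ = allTouches (suc (toℕ u)) (toℕ v) b run
    tʳ = allTouches (suc (toℕ v)) hi r run
  mixed-node {lo} {hi} {l} {v} {_} fˡ (node {a} {u} {b} fᵃ fᵇ) p o@(node oˡ (node oᵃ oᵇ)) (rightBias i c) = begin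
    2 * (cᵛ + (gˡ + (cᵘ + (gᵃ + gᵇ))))
      ≡⟨ solve 5 (λ v u a b l → con 2 :* (v :+ (l :+ (u :+ (a :+ b)))) :=
                                con 2 :* (v :+ u) :+ (con 2 :* a :+ con 2 :* b :+ con 2 :* l)) refl cᵛ cᵘ gᵃ gᵇ gˡ ⟩
    2 * (cᵛ + cᵘ) + (2 * gᵃ + 2 * gᵇ + 2 * gˡ)
      ≤⟨ +-mono-≤ (favored-count (subst (cᵛ ≤_) (+-comm (count X l) cᵘ)
                                   (count-node X (inner∉queries (Full⇒Inner fˡ (node fᵃ fᵇ)) p)))
                                 (subst (cᵘ ≤_) (+-comm (count X a) (count X b))
                                   (count-node X (inner∉queries i (≼-right p))))
                                 (sym a≡b , subst (_≤ tᵘ) a≡b a≤tᵘ)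
                                 (sym l≡a , subst (_≤ tᵛ) l≡a l≤tᵛ))
           (+-mono-≤ (+-mono-≤ (mixed-bound fᵃ (≼-left (≼-right p)) oᵃ) (mixed-bound fᵇ (≼-right (≼-right p)) oᵇ))
                     (mixed-bound fˡ (≼-left p) oˡ)) ⟩
    5 * (tᵛ + tᵘ) + (5 * tᵃ + 5 * tᵇ + 5 * tˡ)
      ≡⟨ solve 5 (λ v u a b l → con 5 :* (v :+ u) :+ (con 5 :* a :+ con 5 :* b :+ con 5 :* l) :=
                                con 5 :* (v :+ (l :+ (u :+ (a :+ b))))) refl tᵛ tᵘ tᵃ tᵇ tˡ ⟩
    5 * (tᵛ + (tˡ + (tᵘ + (tᵃ + tᵇ)))) ∎
    where
    open ≤-Reasoning
    open +-*-Solver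
    bounds = weakʳ-touches run ordered o c
    a≡b  = proj₁ (proj₁ bounds)
    a≤tᵘ = proj₂ (proj₁ bounds)
    l≡a  = proj₁ (proj₂ bounds)
    l≤tᵛ = proj₂ (proj₂ bounds)
    cᵛ = count X (node l v (node a u b))
    cᵘ = count X (node a u b)
    gᵃ = innerQueries fᵃ X
    gᵇ = innerQueries fᵇ X
    gˡ = innerQueries fˡ X
    tᵛ = touches (zone lo (suc (toℕ v)) hi) run
    tᵘ = touches (zone (suc (toℕ v)) (suc (toℕ u)) hi) run
    tᵃ = allTouches (suc (toℕ v)) (toℕ u) a run
    tᵇ = allTouches (suc (toℕ u)) hi b run
    tˡ = allTouches lo (toℕ v) l run

-- Path lengths in the unchanged tree

innerQueries-tail : ∀ {P : BinTree n} (f : Full P) x X → innerQueries f X ≤ innerQueries f (x ∷ X)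
innerQueries-tail single       x X = z≤n
innerQueries-tail (node {l} {v} {r} fˡ fʳ) x X =
  +-mono-≤ (count-tail x X (node l v r)) (+-mono-≤ (innerQueries-tail fˡ x X) (innerQueries-tail fʳ x X))

-- The path to a leaf key consists of that leaf and of the inner nodes whose subtrees contain `x`.
-- The query `x` raises the count of each of these by one, and `suc` pays for the leaf.
path-length : ∀ {P : BinTree n} (f : Full P) → Ordered lo hi P → ∀ {x} X → lo ≤ toℕ x → toℕ x < hi →
              length (path x P) + innerQueries f X ≤ suc (innerQueries f (x ∷ X))
path-length (single {v}) o {x} X _ _ with <-cmp x v
... | tri< _ _ _ = ≤-refl
... | tri≈ _ _ _ = ≤-refl
... | tri> _ _ _ = ≤-refl
path-length (node {l} {v} {r} fˡ fʳ) o@(node oˡ oʳ) {x} X lo≤x x<hi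
  rewrite count-∈ X (node l v r) (range⇒∈ o lo≤x x<hi) with <-cmp x v
... | tri≈ _ _ _ = s≤s (≤-trans (+-monoʳ-≤ (count X (node l v r)) (+-mono-≤ (innerQueries-tail fˡ x X) (innerQueries-tail fʳ x X))) (n≤1+n _))
... | tri< x<v _ _ = s≤s (begin
  length (path x l) + (c + (gˡ + gʳ))
    ≡⟨ solve 4 (λ p c a b → p :+ (c :+ (a :+ b)) := (c :+ (p :+ a)) :+ b) refl (length (path x l)) c gˡ gʳ ⟩
  (c + (length (path x l) + gˡ)) + gʳ
    ≤⟨ +-mono-≤ (+-monoʳ-≤ c (path-length fˡ oˡ X lo≤x x<v)) (innerQueries-tail fʳ x X) ⟩
  (c + suc (innerQueries fˡ (x ∷ X))) + innerQueries fʳ (x ∷ X)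
    ≡⟨ solve 3 (λ c a b → (c :+ (con 1 :+ a)) :+ b := con 1 :+ c :+ (a :+ b)) refl c (innerQueries fˡ (x ∷ X)) _ ⟩
  suc (c + (innerQueries fˡ (x ∷ X) + innerQueries fʳ (x ∷ X))) ∎)
  where
  open ≤-Reasoning
  open +-*-Solver
  c  = count X (node l v r)
  gˡ = innerQueries fˡ X
  gʳ = innerQueries fʳ X
... | tri> _ _ v<x = s≤s (begin
  length (path x r) + (c + (gˡ + gʳ))
    ≡⟨ solve 4 (λ p c a b → p :+ (c :+ (a :+ b)) := (c :+ a) :+ (p :+ b)) refl (length (path x r)) c gˡ gʳ ⟩
  (c + gˡ) + (length (path x r) + gʳ)
    ≤⟨ +-mono-≤ (+-monoʳ-≤ c (innerQueries-tail fˡ x X)) (path-length fʳ oʳ X v<x x<hi) ⟩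
  (c + innerQueries fˡ (x ∷ X)) + suc (innerQueries fʳ (x ∷ X))
    ≡⟨ solve 3 (λ c a b → (c :+ a) :+ (con 1 :+ b) := con 1 :+ c :+ (a :+ b)) refl c (innerQueries fˡ (x ∷ X)) _ ⟩
  suc (c + (innerQueries fˡ (x ∷ X) + innerQueries fʳ (x ∷ X))) ∎)
  where
  open ≤-Reasoning
  open +-*-Solver
  c  = count X (node l v r)
  gˡ = innerQueries fˡ X
  gʳ = innerQueries fʳ X

-- Greedy future

open IsStrictTotalOrder (×-isStrictTotalOrder <-isStrictTotalOrder <-isStrictTotalOrder)
  using () renaming (trans to ≺-trans; irrefl to ≺-irrefl)

leaves-++ : (t : Tree N L) (ks : List L) → Leaves.toDiffList t ks ≡ Leaves.toList t ++ ks
leaves-++ (leaf _)     ks = refl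
leaves-++ (node l v r) ks = begin
  Leaves.toDiffList l (Leaves.toDiffList r ks)      ≡⟨ leaves-++ l _ ⟩
  Leaves.toList l ++ Leaves.toDiffList r ks         ≡⟨ cong (Leaves.toList l ++_) (leaves-++ r ks) ⟩
  Leaves.toList l ++ Leaves.toList r ++ ks          ≡⟨ ++-assoc (Leaves.toList l) _ ks ⟨
  (Leaves.toList l ++ Leaves.toList r) ++ ks        ≡⟨ cong (_++ ks) (leaves-++ l _) ⟨
  Leaves.toList (node l v r) ++ ks                  ∎
  where open ≡-Reasoning

length-leaves : (t : Tree N L) → length (Leaves.toList t) ≡ suc (length (Infix.toList t))
length-leaves (leaf _)     = refl
length-leaves (node l v r) = begin
  length (Leaves.toList (node l v r))                        ≡⟨ cong length (leaves-++ l _) ⟩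
  length (Leaves.toList l ++ Leaves.toList r)                ≡⟨ length-++ (Leaves.toList l) ⟩
  length (Leaves.toList l) + length (Leaves.toList r)        ≡⟨ cong₂ _+_ (length-leaves l) (length-leaves r) ⟩
  suc (length (Infix.toList l) + suc (length (Infix.toList r)))  ≡⟨ cong suc (length-++ (Infix.toList l)) ⟨
  suc (length (Infix.toList l ++ v ∷ Infix.toList r))        ≡⟨ cong (suc ∘ length) (infix-node l v r) ⟨
  suc (length (Infix.toList (node l v r)))                   ∎
  where open ≡-Reasoning

++-split : ∀ {A : Set} (as cs : List A) {bs ds} → length as ≡ length cs → as ++ bs ≡ cs ++ ds → as ≡ cs × bs ≡ ds
++-split []       []       _  eq = refl , eq
++-split (a ∷ as) (c ∷ cs) le eq with ∷-injective eq
... | refl , eq′ = let p , q = ++-split as cs (suc-injective le) eq′ in cong (a ∷_) p , q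

++-split-∉ : ∀ {A : Set} {v : A} as cs {bs ds} → v ∉ˡ as → v ∉ˡ cs → as ++ v ∷ bs ≡ cs ++ v ∷ ds → as ≡ cs × bs ≡ ds
++-split-∉ []       []       _  _  eq = refl , proj₂ (∷-injective eq)
++-split-∉ []       (c ∷ cs) _  v∉ eq = contradiction (here (∷-injectiveˡ eq)) v∉
++-split-∉ (a ∷ as) []       v∉ _  eq = contradiction (here (sym (∷-injectiveˡ eq))) v∉
++-split-∉ (a ∷ as) (c ∷ cs) v∉ v∉′ eq with ∷-injective eq
... | refl , eq′ = let p , q = ++-split-∉ as cs (v∉ ∘ there) (v∉′ ∘ there) eq′ in cong (a ∷_) p , q

module _ {f : N → ℕ × ℕ} where

  heap-left : ∀ {l r : Tree N L} {v u} → IsHeap f (node l v r) → u ∈ˡ Infix.toList l → f v ≺ f u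
  heap-right : ∀ {l r : Tree N L} {v u} → IsHeap f (node l v r) → u ∈ˡ Infix.toList r → f v ≺ f u
  heap-left {l = node a w b} h p with ∈-node⁻ {l = a} {b} p
  ... | inj₁ q           = ≺-trans (h toLeft) (heap-left {l = a} {b} (h ∘ left) q)
  ... | inj₂ (inj₁ refl) = h toLeft
  ... | inj₂ (inj₂ q)    = ≺-trans (h toLeft) (heap-right {l = a} {b} (h ∘ left) q)
  heap-right {r = node a w b} h p with ∈-node⁻ {l = a} {b} p
  ... | inj₁ q           = ≺-trans (h toRight) (heap-left {l = a} {b} (h ∘ right) q)
  ... | inj₂ (inj₁ refl) = h toRight
  ... | inj₂ (inj₂ q)    = ≺-trans (h toRight) (heap-right {l = a} {b} (h ∘ right) q)

  heap-root : ∀ {l r : Tree N L} {v u} → IsHeap f (node l v r) → u ∈ˡ Infix.toList (node l v r) → u ≡ v ⊎ f v ≺ f u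
  heap-root {l = l} {r} h p with ∈-node⁻ {l = l} {r} p
  ... | inj₁ q        = inj₂ (heap-left {l = l} {r} h q)
  ... | inj₂ (inj₁ q) = inj₁ q
  ... | inj₂ (inj₂ q) = inj₂ (heap-right {l = l} {r} h q)

  roots-equal : ∀ {l r l′ r′ : Tree N L} {v v′} → IsHeap f (node l v r) → IsHeap f (node l′ v′ r′) →
                Infix.toList (node l v r) ≡ Infix.toList (node l′ v′ r′) → v ≡ v′
  roots-equal {l = l} {r} {l′} {r′} {v} {v′} h h′ e
    with heap-root {l = l} {r} h (subst (v′ ∈ˡ_) (sym e) (∈-root {l = l′} {r′}))
       | heap-root {l = l′} {r′} h′ (subst (v ∈ˡ_) e (∈-root {l = l} {r}))
  ... | inj₁ v′≡v | _         = sym v′≡v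
  ... | inj₂ _    | inj₁ v≡v′ = v≡v′
  ... | inj₂ v≺v′ | inj₂ v′≺v = contradiction (≺-trans v≺v′ v′≺v) (≺-irrefl (refl , refl))

  -- Strict priorities determine the root and keep its key out of both subtrees, so the key lists
  -- split there uniquely; the leaf lists then split by length. Hence greedy future leaves the tree
  -- alone as soon as the spine is a heap.
  treap-unique : ∀ (S S′ : Tree N L) → IsHeap f S → IsHeap f S′ →
                 Infix.toList S ≡ Infix.toList S′ → Leaves.toList S ≡ Leaves.toList S′ → S ≡ S′
  treap-unique (leaf x) (leaf y) _ _ _ e = cong leaf (∷-injectiveˡ e)
  treap-unique (leaf x) (node l v r) _ _ e _ = contradiction (subst (v ∈ˡ_) (sym e) (∈-root {l = l} {r})) λ ()
  treap-unique (node l v r) (leaf y) _ _ e _ = contradiction (subst (v ∈ˡ_) e (∈-root {l = l} {r})) λ ()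
  treap-unique (node l v r) (node l′ v′ r′) h h′ e eˡ with roots-equal {l = l} {r} {l′} {r′} h h′ e
  ... | refl =
    cong₂ (λ a b → node a v b)
      (treap-unique l l′ (h ∘ left) (h′ ∘ left) (proj₁ infixes) (proj₁ leaves))
      (treap-unique r r′ (h ∘ right) (h′ ∘ right) (proj₂ infixes) (proj₂ leaves))
    where
    infixes = ++-split-∉ (Infix.toList l) (Infix.toList l′)
      (λ v∈ → ≺-irrefl (refl , refl) (heap-left {l = l} {r} h v∈))
      (λ v∈ → ≺-irrefl (refl , refl) (heap-left {l = l′} {r′} h′ v∈))
      (trans (sym (infix-node l v r)) (trans e (infix-node l′ v r′)))
    leaves = ++-split (Leaves.toList l) (Leaves.toList l′)
      (trans (length-leaves l) (trans (cong (suc ∘ length) (proj₁ infixes)) (sym (length-leaves l′))))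
      (trans (sym (leaves-++ l _)) (trans eˡ (leaves-++ l′ _)))

path⇒range : ∀ {P : BinTree n} {x w} → Ordered lo hi P → w ∈ˡ path x P → lo ≤ toℕ w × toℕ w < hi
path⇒range leaf ()
path⇒range {x = x} (node {v = v} oˡ oʳ) p with <-cmp x v
path⇒range (node oˡ oʳ) (here refl) | tri< _ _ _ = Ordered⇒≤ oˡ , Ordered⇒≤ oʳ
path⇒range (node oˡ oʳ) (here refl) | tri≈ _ _ _ = Ordered⇒≤ oˡ , Ordered⇒≤ oʳ
path⇒range (node oˡ oʳ) (here refl) | tri> _ _ _ = Ordered⇒≤ oˡ , Ordered⇒≤ oʳ
path⇒range {x = x} (node oˡ oʳ) (there p) | tri< _ _ _ =
  let lo≤ , <v = path⇒range {x = x} oˡ p in lo≤ , <-trans <v (Ordered⇒≤ oʳ)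
path⇒range {x = x} (node oˡ oʳ) (there p) | tri> _ _ _ =
  let v< , <hi = path⇒range {x = x} oʳ p in ≤-trans (Ordered⇒≤ oˡ) (<⇒≤ v<) , <hi

depth-root : ∀ (l : BinTree n) v r → depth (node l v r) v ≡ 1
depth-root l v r with <-cmp v v
... | tri< _ v≢v _ = contradiction refl v≢v
... | tri≈ _ _ _ = refl
... | tri> _ v≢v _ = contradiction refl v≢v

depth-left : ∀ (l : BinTree n) {v} r {w} → toℕ w < toℕ v → depth (node l v r) w ≡ suc (depth l w)
depth-left l {v} r {w} w<v with <-cmp w v
... | tri< _ _ _ = refl
... | tri≈ w≮v _ _ = contradiction w<v w≮v
... | tri> w≮v _ _ = contradiction w<v w≮v

depth-right : ∀ (l : BinTree n) {v} r {w} → toℕ v < toℕ w → depth (node l v r) w ≡ suc (depth r w)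
depth-right l {v} r {w} v<w with <-cmp w v
... | tri< _ _ v≮w = contradiction v<w v≮w
... | tri≈ _ _ v≮w = contradiction v<w v≮w
... | tri> _ _ _ = refl

spine-root : ∀ x {a b : BinTree n} {w S v S′} → spine x (node a w b) ≡ node S v S′ → w ≡ v
spine-root x {w = w} e with <-cmp x w
spine-root x refl | tri< _ _ _ = refl
spine-root x refl | tri≈ _ _ _ = refl
spine-root x refl | tri> _ _ _ = refl

Full-spine-root : ∀ x {P : BinTree n} {S v S′} → Full P → spine x P ≡ node S v S′ → ∃₂ λ a b → P ≡ node a v b
Full-spine-root x (single {v})              e with refl ← spine-root x {leaf _} {leaf _} {v} e = _ , _ , refl
Full-spine-root x (node {l} {v} {r} fˡ fʳ) e with refl ← spine-root x {l} {r} {v} e = _ , _ , refl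

edge-left⁻ : ∀ {S : Tree N L} {v ℓ p u} → Edge (node S v (leaf ℓ)) p u →
             (p ≡ v × ∃₂ λ a b → S ≡ node a u b) ⊎ Edge S p u
edge-left⁻ toLeft   = inj₁ (refl , _ , _ , refl)
edge-left⁻ (left e) = inj₂ e

edge-right⁻ : ∀ {S : Tree N L} {v ℓ p u} → Edge (node (leaf ℓ) v S) p u →
              (p ≡ v × ∃₂ λ a b → S ≡ node a u b) ⊎ Edge S p u
edge-right⁻ toRight   = inj₁ (refl , _ , _ , refl)
edge-right⁻ (right e) = inj₂ e

-- Scan `X` up to its first query `y` to `S`. No earlier query is in the gap of `u`, and `y`, being
-- linked to `x` by `R`, is in the gap of `v`.
τ-≤ : ∀ {P : List (Fin n)} {S : BinTree n} {v u x} {R : Fin n → Fin n → Set} →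
      (∀ {y} → R x y → InGap P v y) → (∀ {y} → InGap P u y → y ∈ˡ keys S) →
      ∀ X → Linked R (x ∷ (X ∣ᵗ S)) → τ P X v ≤ τ P X u
τ-≤ gapᵛ gapᵘ [] _ = z≤n
τ-≤ {P = P} {S} {v} {u} gapᵛ gapᵘ (y ∷ X) c with inGap? P v y | inGap? P u y | member? _≟ᶠ_ y (keys S)
... | yes _  | _      | _      = z≤n
... | no _   | yes iu | no y∉  = contradiction (gapᵘ iu) y∉
... | no _   | no _   | no _   = s≤s (τ-≤ {S = S} {v} {u} gapᵛ gapᵘ X c)
τ-≤ gapᵛ gapᵘ (y ∷ X) (Rxy ∷ c) | no ¬iv | _ | yes _ = contradiction (gapᵛ Rxy) ¬iv

root-depth : ∀ {P : BinTree n} {u} → Ordered lo hi P → (∃₂ λ a b → P ≡ node a u b) →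
             lo ≤ toℕ u × toℕ u < hi × depth P u ≡ 1
root-depth {u = u} (node {l = a} {r = b} oᵃ oᵇ) (_ , _ , refl) = Ordered⇒≤ oᵃ , Ordered⇒≤ oᵇ , depth-root a u b

Linked-tail : ∀ {R : Fin n → Fin n → Set} x X S → Linked R ((x ∷ X) ∣ᵗ S) → Linked R (X ∣ᵗ S)
Linked-tail x X S c with member? _≟ᶠ_ x (keys S)
... | yes _ = Linked.tail c
... | no _  = c

module _ {n : ℕ} {T : BinTree n} {x : Fin n} {X : List (Fin n)} (κ : Fin n → Kind)
         (stable : ∀ {l v r} → node l v r ≼ T → Inner (node l v r) →
                   StableNode ((x ∷ X) ∣ᵗ node l v r) (κ v) (node l v r)) where

  private
    priority : Fin n → ℕ × ℕ
    priority v = τ (path x T) X v , depth T v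

  -- The next query after x to the subtree of v, if any, lies beyond the
  -- part of the path below v.

  next-beyondˡ : ∀ {lo hi l v r} → Ordered lo hi (node l v r) → node l v r ≼ T → Inner (node l v r) → toℕ x < toℕ v →
                 Linked (λ p q → p ≡ x → q ∈ˡ keys (node l v r) × (∀ {w} → w ∈ˡ path x l → toℕ w < toℕ q))
                        ((x ∷ X) ∣ᵗ node l v r)
  next-beyondˡ {l = l} {v} {r} (node oˡ oʳ) p i x<v with κ v | stable p i
  ... | _ | alternating c = Linked.map step c
    where
    -- `Linked.map` visits every consecutive pair, so the claim is guarded by `p ≡ x`; a step
    -- starting in `r` contradicts `x<v`.
    step : ∀ {p q} → Step l r p q ⊎ Step r l p q → p ≡ x →
           q ∈ˡ keys (node l v r) × (∀ {w} → w ∈ˡ path x l → toℕ w < toℕ q)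
    step (inj₁ (_ , q∈r)) refl = ∈-right {l = l} {r} q∈r ,
      λ w∈ → <-trans (proj₂ (path⇒range {P = l} {x = x} oˡ w∈)) (proj₁ (∈⇒range oʳ q∈r))
    step (inj₂ (x∈r , _)) refl = contradiction x<v (<⇒≯ (proj₁ (∈⇒range oʳ x∈r)))
  ... | _ | rightBias {a = a} {u} {b} _ c = Linked.map step c
    where
    step : ∀ {p q} → Step b a p q ⊎ Step a l p q ⊎ Step l b p q → p ≡ x →
           q ∈ˡ keys (node l v r) × (∀ {w} → w ∈ˡ path x l → toℕ w < toℕ q)
    step (inj₁ (x∈b , _)) refl =
      contradiction x<v (<⇒≯ (proj₁ (∈⇒range oʳ (∈-right {l = a} {b} x∈b))))
    step (inj₂ (inj₁ (x∈a , _))) refl =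
      contradiction x<v (<⇒≯ (proj₁ (∈⇒range oʳ (∈-left {l = a} {b} x∈a))))
    step (inj₂ (inj₂ (_ , q∈b))) refl = let q∈r = ∈-right {l = a} {b} q∈b in
      ∈-right {l = l} {r} q∈r , λ w∈ → <-trans (proj₂ (path⇒range {P = l} {x = x} oˡ w∈)) (proj₁ (∈⇒range oʳ q∈r))
  next-beyondˡ {v = v} {r} (node oˡ@(node oᵃ oᵇ) oʳ) p i x<v | _ | leftBias {a = a} {u} {b} _ c = Linked.map step c
    where
    l = node a u b
    -- Under a left bias a query to `a` is followed by one that is still left of `v`. It is in `b`,
    -- however, while the path below `v` runs through `u` into `a`.
    beyond : ∀ {q} → x ∈ˡ keys a → q ∈ˡ keys b → ∀ {w} → w ∈ˡ path x l → toℕ w < toℕ q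
    beyond x∈a q∈b w∈ with <-cmp x u | w∈
    ... | tri< _ _ _   | here refl = proj₁ (∈⇒range oᵇ q∈b)
    ... | tri< _ _ _   | there w∈′ = <-trans (proj₂ (path⇒range {P = a} {x = x} oᵃ w∈′)) (proj₁ (∈⇒range oᵇ q∈b))
    ... | tri≈ x≮u _ _ | _         = contradiction (proj₂ (∈⇒range oᵃ x∈a)) x≮u
    ... | tri> x≮u _ _ | _         = contradiction (proj₂ (∈⇒range oᵃ x∈a)) x≮u
    step : ∀ {p q} → Step a b p q ⊎ Step b r p q ⊎ Step r a p q → p ≡ x →
           q ∈ˡ keys (node l v r) × (∀ {w} → w ∈ˡ path x l → toℕ w < toℕ q)
    step (inj₁ (x∈a , q∈b)) refl = ∈-left {l = l} {r} (∈-right {l = a} {b} q∈b) , beyond x∈a q∈b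
    step (inj₂ (inj₁ (_ , q∈r))) refl = ∈-right {l = l} {r} q∈r ,
      λ w∈ → <-trans (proj₂ (path⇒range {P = l} {x = x} oˡ w∈)) (proj₁ (∈⇒range oʳ q∈r))
    step (inj₂ (inj₂ (x∈r , _))) refl = contradiction x<v (<⇒≯ (proj₁ (∈⇒range oʳ x∈r)))

  next-beyondʳ : ∀ {lo hi l v r} → Ordered lo hi (node l v r) → node l v r ≼ T → Inner (node l v r) → toℕ v < toℕ x →
                 Linked (λ p q → p ≡ x → q ∈ˡ keys (node l v r) × (∀ {w} → w ∈ˡ path x r → toℕ q < toℕ w))
                        ((x ∷ X) ∣ᵗ node l v r)
  next-beyondʳ {l = l} {v} {r} (node oˡ oʳ) p i v<x with κ v | stable p i
  ... | _ | alternating c = Linked.map step c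
    where
    step : ∀ {p q} → Step l r p q ⊎ Step r l p q → p ≡ x →
           q ∈ˡ keys (node l v r) × (∀ {w} → w ∈ˡ path x r → toℕ q < toℕ w)
    step (inj₂ (_ , q∈l)) refl = ∈-left {l = l} {r} q∈l ,
      λ w∈ → <-trans (proj₂ (∈⇒range oˡ q∈l)) (proj₁ (path⇒range {P = r} {x = x} oʳ w∈))
    step (inj₁ (x∈l , _)) refl = contradiction v<x (<⇒≯ (proj₂ (∈⇒range oˡ x∈l)))
  ... | _ | leftBias {a = a} {u} {b} _ c = Linked.map step c
    where
    step : ∀ {p q} → Step a b p q ⊎ Step b r p q ⊎ Step r a p q → p ≡ x →
           q ∈ˡ keys (node l v r) × (∀ {w} → w ∈ˡ path x r → toℕ q < toℕ w)
    step (inj₁ (x∈a , _)) refl =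
      contradiction v<x (<⇒≯ (proj₂ (∈⇒range oˡ (∈-left {l = a} {b} x∈a))))
    step (inj₂ (inj₁ (x∈b , _))) refl =
      contradiction v<x (<⇒≯ (proj₂ (∈⇒range oˡ (∈-right {l = a} {b} x∈b))))
    step (inj₂ (inj₂ (_ , q∈a))) refl = let q∈l = ∈-left {l = a} {b} q∈a in
      ∈-left {l = l} {r} q∈l , λ w∈ → <-trans (proj₂ (∈⇒range oˡ q∈l)) (proj₁ (path⇒range {P = r} {x = x} oʳ w∈))
  next-beyondʳ {l = l} {v} (node oˡ oʳ@(node oᵃ oᵇ)) p i v<x | _ | rightBias {a = a} {u} {b} _ c = Linked.map step c
    where
    r = node a u b
    beyond : ∀ {q} → x ∈ˡ keys b → q ∈ˡ keys a → ∀ {w} → w ∈ˡ path x r → toℕ q < toℕ w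
    beyond x∈b q∈a w∈ with <-cmp x u | w∈
    ... | tri> _ _ _   | here refl = proj₂ (∈⇒range oᵃ q∈a)
    ... | tri> _ _ _   | there w∈′ = <-trans (proj₂ (∈⇒range oᵃ q∈a)) (proj₁ (path⇒range {P = b} {x = x} oᵇ w∈′))
    ... | tri≈ _ _ u≮x | _         = contradiction (proj₁ (∈⇒range oᵇ x∈b)) u≮x
    ... | tri< _ _ u≮x | _         = contradiction (proj₁ (∈⇒range oᵇ x∈b)) u≮x
    step : ∀ {p q} → Step b a p q ⊎ Step a l p q ⊎ Step l b p q → p ≡ x →
           q ∈ˡ keys (node l v r) × (∀ {w} → w ∈ˡ path x r → toℕ q < toℕ w)
    step (inj₁ (x∈b , q∈a)) refl = ∈-right {l = l} {r} (∈-left {l = a} {b} q∈a) , beyond x∈b q∈a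
    step (inj₂ (inj₁ (x∈a , q∈l))) refl = ∈-left {l = l} {r} q∈l ,
      λ w∈ → <-trans (proj₂ (∈⇒range oˡ q∈l)) (proj₁ (path⇒range {P = r} {x = x} oʳ w∈))
    step (inj₂ (inj₂ (x∈l , _))) refl = contradiction v<x (<⇒≯ (proj₂ (∈⇒range oˡ x∈l)))

  -- By `τ-≤` the parent `v` comes no later than its child `u`, and at equal times its smaller depth
  -- decides. `Q` is the part of the search path from `v` downwards.
  edge-priority : ∀ {lo hi l v r u Q} → Ordered lo hi (node l v r) → lo ≤ toℕ x → toℕ x < hi →
    (∀ {w} → w ∈ˡ path x T → (toℕ w < lo ⊎ hi ≤ toℕ w) ⊎ w ∈ˡ Q) →
    (∀ {u y} → lo ≤ toℕ u → toℕ u < hi → InGap (path x T) u y → lo ≤ toℕ y × toℕ y < hi) →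
    ∀ k → (∀ {w} → lo ≤ toℕ w → toℕ w < hi → depth T w ≡ k + depth (node l v r) w) →
    lo ≤ toℕ u → toℕ u < hi → depth (node l v r) u ≡ 2 →
    Linked (λ p q → p ≡ x → q ∈ˡ keys (node l v r) ×
                    (∀ {w} → w ∈ˡ Q → (toℕ w < toℕ v → toℕ w < toℕ q) × (toℕ v < toℕ w → toℕ q < toℕ w)))
           ((x ∷ X) ∣ᵗ node l v r) →
    priority v ≺ priority u
  edge-priority {lo} {hi} {l} {v} {r} {u} {Q} o@(node oˡ oʳ) lo≤x x<hi outside gap k dep lo≤u u<hi depth≡2 c =
    lex (m≤n⇒m<n∨m≡n earlier)
    where
    lo≤v = Ordered⇒≤ oˡ
    v<hi = Ordered⇒≤ oʳ
    beyond⇒gap : ∀ {y} → (x ≡ x → y ∈ˡ keys (node l v r) ×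
      (∀ {w} → w ∈ˡ Q → (toℕ w < toℕ v → toℕ w < toℕ y) × (toℕ v < toℕ w → toℕ y < toℕ w))) →
      InGap (path x T) v y
    beyond⇒gap {y} h = All.tabulate inGap
      where
      lo≤y = proj₁ (∈⇒range o (proj₁ (h refl)))
      y<hi = proj₂ (∈⇒range o (proj₁ (h refl)))
      inGap : ∀ {w} → w ∈ˡ path x T → (toℕ w < toℕ v → toℕ w < toℕ y) × (toℕ v < toℕ w → toℕ y < toℕ w)
      inGap w∈ with outside w∈
      ... | inj₁ (inj₁ w<lo) = (λ _ → <-≤-trans w<lo lo≤y) , (λ v<w → contradiction (<-≤-trans w<lo lo≤v) (<⇒≯ v<w))
      ... | inj₁ (inj₂ hi≤w) = (λ w<v → contradiction (<-≤-trans v<hi hi≤w) (<⇒≯ w<v)) , (λ _ → <-≤-trans y<hi hi≤w)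
      ... | inj₂ w∈Q         = proj₂ (h refl) w∈Q
    earlier : τ (path x T) X v ≤ τ (path x T) X u
    earlier = τ-≤ {S = node l v r} {v} {u} beyond⇒gap
      (λ g → let lo≤y , y<hi = gap lo≤u u<hi g in range⇒∈ o lo≤y y<hi)
      X (subst (Linked _) (filter-accept (λ y → member? _≟ᶠ_ y (keys (node l v r))) (range⇒∈ o lo≤x x<hi)) c)
    deeper : depth T v < depth T u
    deeper = begin-strict
      depth T v                    ≡⟨ dep lo≤v v<hi ⟩
      k + depth (node l v r) v     ≡⟨ cong (k +_) (depth-root l v r) ⟩
      k + 1                        <⟨ +-monoʳ-< k (n<1+n 1) ⟩
      k + 2                        ≡⟨ cong (k +_) depth≡2 ⟨
      k + depth (node l v r) u     ≡⟨ dep lo≤u u<hi ⟨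
      depth T u                    ∎
      where open ≤-Reasoning
    lex : _ < _ ⊎ _ ≡ _ → priority v ≺ priority u
    lex (inj₁ τ<) = inj₁ τ<
    lex (inj₂ τ≡) = inj₂ (τ≡ , deeper)

  -- Induction down the search path. The invariants say that path keys above `S` lie outside its key
  -- range, that the gap of a key in the range stays in it, because the range is bounded by path
  -- keys or by the ends of the key set, and that depths in `T` and `S` differ by `k`.
  spine-heap : ∀ {lo hi S} (f : Full S) → Ordered lo hi S → S ≼ T → lo ≤ toℕ x → toℕ x < hi →
    (∀ {w} → w ∈ˡ path x T → (toℕ w < lo ⊎ hi ≤ toℕ w) ⊎ w ∈ˡ path x S) →
    (∀ {w} → w ∈ˡ path x S → w ∈ˡ path x T) →
    (∀ {u y} → lo ≤ toℕ u → toℕ u < hi → InGap (path x T) u y → lo ≤ toℕ y × toℕ y < hi) →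
    ∀ k → (∀ {w} → lo ≤ toℕ w → toℕ w < hi → depth T w ≡ k + depth S w) →
    IsHeap priority (spine x S)
  spine-heap (single {v}) o p lo≤x x<hi outside inside gap k dep e with <-cmp x v
  spine-heap single o p lo≤x x<hi outside inside gap k dep (left ()) | tri< _ _ _
  spine-heap single o p lo≤x x<hi outside inside gap k dep (right ()) | tri< _ _ _
  spine-heap single o p lo≤x x<hi outside inside gap k dep (left ()) | tri≈ _ _ _
  spine-heap single o p lo≤x x<hi outside inside gap k dep (right ()) | tri≈ _ _ _
  spine-heap single o p lo≤x x<hi outside inside gap k dep (left ()) | tri> _ _ _
  spine-heap single o p lo≤x x<hi outside inside gap k dep (right ()) | tri> _ _ _
  spine-heap {lo} {hi} (node {l} {v} {r} fˡ fʳ) o@(node oˡ oʳ) p lo≤x x<hi outside inside gap k dep e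
    with <-cmp x v
  spine-heap (node fˡ fʳ) o@(node oˡ oʳ) p lo≤x x<hi outside inside gap k dep (left ()) | tri≈ _ _ _
  spine-heap (node fˡ fʳ) o@(node oˡ oʳ) p lo≤x x<hi outside inside gap k dep (right ()) | tri≈ _ _ _
  ... | tri< x<v _ _ with edge-left⁻ e
  ...   | inj₂ e′ = spine-heap fˡ oˡ (≼-left p) lo≤x x<v outside′ (inside ∘ there) gap′ (suc k) dep′ e′
    where
    outside′ : ∀ {w} → w ∈ˡ path x T → (toℕ w < lo ⊎ toℕ v ≤ toℕ w) ⊎ w ∈ˡ path x l
    outside′ w∈ with outside w∈
    ... | inj₁ (inj₁ w<lo)  = inj₁ (inj₁ w<lo)
    ... | inj₁ (inj₂ hi≤w)  = inj₁ (inj₂ (≤-trans (<⇒≤ (Ordered⇒≤ oʳ)) hi≤w))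
    ... | inj₂ (here refl)  = inj₁ (inj₂ ≤-refl)
    ... | inj₂ (there w∈′)  = inj₂ w∈′
    gap′ : ∀ {u y} → lo ≤ toℕ u → toℕ u < toℕ v → InGap (path x T) u y → lo ≤ toℕ y × toℕ y < toℕ v
    gap′ lo≤u u<v g = proj₁ (gap lo≤u (<-trans u<v (Ordered⇒≤ oʳ)) g) , proj₂ (All.lookup g (inside (here refl))) u<v
    dep′ : ∀ {w} → lo ≤ toℕ w → toℕ w < toℕ v → depth T w ≡ suc k + depth l w
    dep′ lo≤w w<v = trans (dep lo≤w (<-trans w<v (Ordered⇒≤ oʳ)))
      (trans (cong (k +_) (depth-left l r w<v)) (+-suc k _))
  ...   | inj₁ (refl , _ , _ , eq) = let lo≤u , u<v , d = root-depth oˡ (Full-spine-root x fˡ eq) in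
    edge-priority o lo≤x x<hi outside gap k dep lo≤u (<-trans u<v (Ordered⇒≤ oʳ))
      (trans (depth-left l r u<v) (cong suc d))
      (Linked.map (λ g p≡x → proj₁ (g p≡x) , λ
        { (here refl) → (λ v<v → contradiction v<v (<-irrefl refl)) , (λ v<v → contradiction v<v (<-irrefl refl))
        ; (there w∈)  → (λ _ → proj₂ (g p≡x) w∈) ,
                        (λ v<w → contradiction (proj₂ (path⇒range {P = l} {x = x} oˡ w∈)) (<⇒≯ v<w)) })
        (next-beyondˡ o p (Full⇒Inner fˡ fʳ) x<v))
  spine-heap {lo} {hi} (node {l} {v} {r} fˡ fʳ) o@(node oˡ oʳ) p lo≤x x<hi outside inside gap k dep e
    | tri> _ _ v<x with edge-right⁻ e
  ...   | inj₂ e′ = spine-heap fʳ oʳ (≼-right p) v<x x<hi outside′ (inside ∘ there) gap′ (suc k) dep′ e′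
    where
    outside′ : ∀ {w} → w ∈ˡ path x T → (toℕ w < suc (toℕ v) ⊎ hi ≤ toℕ w) ⊎ w ∈ˡ path x r
    outside′ w∈ with outside w∈
    ... | inj₁ (inj₁ w<lo)  = inj₁ (inj₁ (≤-trans w<lo (m≤n⇒m≤1+n (Ordered⇒≤ oˡ))))
    ... | inj₁ (inj₂ hi≤w)  = inj₁ (inj₂ hi≤w)
    ... | inj₂ (here refl)  = inj₁ (inj₁ ≤-refl)
    ... | inj₂ (there w∈′)  = inj₂ w∈′
    gap′ : ∀ {u y} → toℕ v < toℕ u → toℕ u < hi → InGap (path x T) u y → toℕ v < toℕ y × toℕ y < hi
    gap′ v<u u<hi g = proj₁ (All.lookup g (inside (here refl))) v<u ,
                      proj₂ (gap (≤-trans (Ordered⇒≤ oˡ) (<⇒≤ v<u)) u<hi g)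
    dep′ : ∀ {w} → toℕ v < toℕ w → toℕ w < hi → depth T w ≡ suc k + depth r w
    dep′ v<w w<hi = trans (dep (≤-trans (Ordered⇒≤ oˡ) (<⇒≤ v<w)) w<hi)
      (trans (cong (k +_) (depth-right l r v<w)) (+-suc k _))
  ...   | inj₁ (refl , _ , _ , eq) = let v<u , u<hi , d = root-depth oʳ (Full-spine-root x fʳ eq) in
    edge-priority o lo≤x x<hi outside gap k dep (≤-trans (Ordered⇒≤ oˡ) (<⇒≤ v<u)) u<hi
      (trans (depth-right l r v<u) (cong suc d))
      (Linked.map (λ g p≡x → proj₁ (g p≡x) , λ
        { (here refl) → (λ v<v → contradiction v<v (<-irrefl refl)) , (λ v<v → contradiction v<v (<-irrefl refl))
        ; (there w∈)  → (λ w<v → contradiction (proj₁ (path⇒range {P = r} {x = x} oʳ w∈)) (<⇒≯ w<v)) ,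
                        (λ _ → proj₂ (g p≡x) w∈) })
        (next-beyondʳ o p (Full⇒Inner fˡ fʳ) v<x))

-- The cost of greedy future

graft-spine : ∀ (x : Fin n) T → graft (spine x T) ≡ T
graft-spine x (leaf _) = refl
graft-spine x (node l v r) with <-cmp x v
... | tri< _ _ _ = cong (λ l → node l v r) (graft-spine x l)
... | tri≈ _ _ _ = refl
... | tri> _ _ _ = cong (node l v) (graft-spine x r)

GF-static : ∀ {T T′ : BinTree n} {x X} → Full T → Ordered 0 n T → (κ : Fin n → Kind) →
            (∀ {l v r} → node l v r ≼ T → Inner (node l v r) → StableNode ((x ∷ X) ∣ᵗ node l v r) (κ v) (node l v r)) →
            GFTree x X T T′ → T′ ≡ T
GF-static {T = T} {x = x} f o κ stable gf =
  trans (GFTree.result gf) (trans (cong graft S≡spine) (graft-spine x T))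
  where
  S≡spine = treap-unique (GFTree.S gf) (spine x T) (GFTree.heap gf)
    (spine-heap κ stable f o here z≤n (toℕ<n x) inj₂ id (λ {_} {y} _ _ _ → z≤n , toℕ<n y) 0 (λ _ _ → refl))
    (GFTree.keyOrder gf) (GFTree.hanging gf)

StableNode-tail : ∀ {x : Fin n} {X k S} → StableNode ((x ∷ X) ∣ᵗ S) k S → StableNode (X ∣ᵗ S) k S
StableNode-tail {x = x} {X} (alternating {l} {v} {r} c) = alternating (Linked-tail x X (node l v r) c)
StableNode-tail {x = x} {X} (leftBias {a} {u} {b} {v} {r} i c) = leftBias i (Linked-tail x X (node (node a u b) v r) c)
StableNode-tail {x = x} {X} (rightBias {l} {v} {a} {u} {b} i c) = rightBias i (Linked-tail x X (node l v (node a u b)) c)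

∈-⋃⁻ : ∀ {w : Fin n} ws → w ∈ ⋃ (map ⁅_⁆ ws) → w ∈ˡ ws
∈-⋃⁻ []       p = contradiction p ∉⊥
∈-⋃⁻ (v ∷ ws) p with x∈p∪q⁻ ⁅ v ⁆ (⋃ (map ⁅_⁆ ws)) p
... | inj₁ q = here (x∈⁅y⁆⇒x≡y v q)
... | inj₂ q = there (∈-⋃⁻ ws q)

∣p∪q∣≤∣p∣+∣q∣ : ∀ {n} (p q : Subset n) → ∣ p ∪ q ∣ ≤ ∣ p ∣ + ∣ q ∣
∣p∪q∣≤∣p∣+∣q∣ []          []          = z≤n
∣p∪q∣≤∣p∣+∣q∣ (false ∷ p) (false ∷ q) = ∣p∪q∣≤∣p∣+∣q∣ p q
∣p∪q∣≤∣p∣+∣q∣ (false ∷ p) (true ∷ q)  = ≤-trans (s≤s (∣p∪q∣≤∣p∣+∣q∣ p q)) (≤-reflexive (sym (+-suc ∣ p ∣ ∣ q ∣)))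
∣p∪q∣≤∣p∣+∣q∣ (true ∷ p)  (false ∷ q) = s≤s (∣p∪q∣≤∣p∣+∣q∣ p q)
∣p∪q∣≤∣p∣+∣q∣ (true ∷ p)  (true ∷ q)  = s≤s (≤-trans (∣p∪q∣≤∣p∣+∣q∣ p q) (+-monoʳ-≤ ∣ p ∣ (n≤1+n ∣ q ∣)))

∣⋃∣≤length : ∀ {n} (ws : List (Fin n)) → ∣ ⋃ (map ⁅_⁆ ws) ∣ ≤ length ws
∣⋃∣≤length {n} [] = ≤-reflexive (∣⊥∣≡0 n)
∣⋃∣≤length (w ∷ ws) = ≤-trans (∣p∪q∣≤∣p∣+∣q∣ ⁅ w ⁆ _) (+-mono-≤ (≤-reflexive (∣⁅x⁆∣≡1 w)) (∣⋃∣≤length ws))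

root-connected : ∀ {x : Fin n} {l v r} {Q : Fin n → Set} → (∀ {w} → w ∈ˡ path x (node l v r) → Q w) →
                 ∀ {b} → b ∈ˡ path x (node l v r) →
                 EqClosure (λ y z → Edge (node l v r) y z × Q y × Q z) v b
root-connected {x = x} {l} {v} {r} q p with <-cmp x v
root-connected q (here refl) | tri< _ _ _ = ε
root-connected q (here refl) | tri≈ _ _ _ = ε
root-connected q (here refl) | tri> _ _ _ = ε
root-connected {x = x} {node a u b} q (there p) | tri< _ _ _ =
  fwd (toLeft , q (here refl) , q (there (root∈path x))) ◅
  EqClosure.map (λ (e , qs) → left e , qs) (root-connected {x = x} {a} {u} {b} (q ∘ there) p)
root-connected {x = x} {r = node a u b} q (there p) | tri> _ _ _ =
  fwd (toRight , q (here refl) , q (there (root∈path x))) ◅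
  EqClosure.map (λ (e , qs) → right e , qs) (root-connected {x = x} {a} {u} {b} (q ∘ there) p)

path-connected : ∀ (x : Fin n) T → Connected T (pathSet x T)
path-connected x (leaf _)     p q = contradiction p ∉⊥
path-connected x T@(node l v r) p q =
  EqClosure.symmetric _ (root-connected {x = x} {l} {v} {r} ∈-⋃ (∈-⋃⁻ (path x T) p)) ◅◅
  root-connected {x = x} {l} {v} {r} ∈-⋃ (∈-⋃⁻ (path x T) q)

-- The path is connected and covers the rotated edges, so by minimality it contains `U`.
path-cost : ∀ {x : Fin n} {T E U} → IsMinimalSubtree T E U → Covers (pathSet x T) E →
            ∣ pathSet x T ∪ U ∣ ≤ length (path x T)
path-cost {x = x} {T} {U = U} m cov =
  ≤-trans (p⊆q⇒∣p∣≤∣q∣ ∪⊆) (∣⋃∣≤length (path x T))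
  where
  ∪⊆ : pathSet x T ∪ U ⊆ pathSet x T
  ∪⊆ p with x∈p∪q⁻ (pathSet x T) U p
  ... | inj₁ q = q
  ... | inj₂ q = IsMinimalSubtree.least m (path-connected x T) cov q

GF-cost : ∀ {T : BinTree n} {X} {run : Run T X} (f : Full T) → Ordered 0 n T → (κ : Fin n → Kind) →
          (∀ {l v r} → node l v r ≼ T → Inner (node l v r) → StableNode (X ∣ᵗ node l v r) (κ v) (node l v r)) →
          IsGF run → cost run ≤ length X + innerQueries f X
GF-cost f o κ stable done = z≤n
GF-cost f o κ stable (serve {T} {x = x} {X} {U = U} {m} {run} gf cov g) with GF-static f o κ stable gf
... | refl = begin
  ∣ pathSet x T ∪ U ∣ + cost run
    ≤⟨ +-mono-≤ (path-cost m cov) (GF-cost f o κ (λ p i → StableNode-tail (stable p i)) g) ⟩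
  length (path x T) + (length X + innerQueries f X)
    ≡⟨ solve 3 (λ p l g → p :+ (l :+ g) := l :+ (p :+ g)) refl (length (path x T)) (length X) (innerQueries f X) ⟩
  length X + (length (path x T) + innerQueries f X)
    ≤⟨ +-monoʳ-≤ (length X) (path-length f o X z≤n (toℕ<n x)) ⟩
  length X + suc (innerQueries f (x ∷ X))
    ≡⟨ +-suc (length X) _ ⟩
  suc (length X) + innerQueries f (x ∷ X) ∎
  where
  open ≤-Reasoning
  open +-*-Solver

-- Whole multiples and the two ratios

repeat-+ : ∀ {A : Set} j k (xs : List A) → repeat j xs ++ repeat k xs ≡ repeat (j + k) xs
repeat-+ zero    k xs = refl
repeat-+ (suc j) k xs = trans (++-assoc xs (repeat j xs) (repeat k xs)) (cong (xs ++_) (repeat-+ j k xs))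

-- Stability of X ++ X says that the patterns in X close up cyclically.

whole-multiple : ∀ {κ} {T : BinTree n} {X} → IsWholeMultiple κ T X → StableAs κ T (X ++ X) × 0 < length X
whole-multiple {κ = κ} {T} (A , k , atomic , refl) =
  subst (StableAs κ T) (sym (repeat-+ (suc k) (suc k) A)) (IsAtomic.repeatable atomic (suc k + suc k)) ,
  positive A (IsAtomic.nonempty atomic)
  where
  positive : ∀ A {B : List _} → A ≢ [] → 0 < length (A ++ B)
  positive []      A≢[] = contradiction refl A≢[]
  positive (_ ∷ _) _    = s≤s z≤n

theorem5 : ∀ {n} (T : BinTree n) → IsBST T → Full T →
    (X : List (Fin n)) (gf opt : Run T X) → IsGF gf → IsOPT opt →
    ((κ : Fin n → Kind) → StableAs κ T X → IsWholeMultiple κ T X → 2 * cost gf < 5 * cost opt)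
    × (StronglyStable T X → IsWholeMultiple (const strong) T X → cost gf < 2 * cost opt)
theorem5 {n} T bst full X gf opt isGF _ = mixed , strongly
  where
  open ≤-Reasoning
  ordered = IsBST⇒Ordered {T = T} bst
  m = length X
  g = innerQueries full X
  c = allTouches 0 n T opt

  mixed : (κ : Fin n → Kind) → StableAs κ T X → IsWholeMultiple κ T X → 2 * cost gf < 5 * cost opt
  mixed κ stable whole = begin-strict
    2 * cost gf      ≤⟨ *-monoʳ-≤ 2 (GF-cost full ordered κ (StableAs.stableNodes stable) isGF) ⟩
    2 * (m + g)      ≡⟨ *-distribˡ-+ 2 m g ⟩
    2 * m + 2 * g    ≤⟨ +-monoʳ-≤ (2 * m) (mixed-bound opt ordered (proj₁ (whole-multiple whole)) full here ordered) ⟩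
    -- Strictness comes from the unit paid by every query, as `X` is nonempty; comparing `g` with
    -- `c` gives no strict inequality.
    2 * m + 5 * c    <⟨ +-monoˡ-< (5 * c) 2m<5m ⟩
    5 * m + 5 * c    ≡⟨ *-distribˡ-+ 5 m c ⟨
    5 * (m + c)      ≤⟨ *-monoʳ-≤ 5 (cost-bound T bst ordered opt) ⟩
    5 * cost opt     ∎
    where
    2m<5m : 2 * m < 5 * m
    2m<5m = *-monoˡ-< m {{>-nonZero (proj₂ (whole-multiple whole))}} {2} {5} (m≤m+n 3 2)

  strongly : StronglyStable T X → IsWholeMultiple (const strong) T X → cost gf < 2 * cost opt
  strongly stable whole = begin-strict
    cost gf          ≤⟨ GF-cost full ordered (const strong) (StableAs.stableNodes stable) isGF ⟩
    m + g            ≤⟨ +-monoʳ-≤ m (strong-bound opt ordered (proj₁ (whole-multiple whole)) (λ _ → refl) full here ordered) ⟩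
    m + 2 * c        <⟨ +-monoˡ-< (2 * c) (m<m+n m (subst (0 <_) (sym (+-identityʳ m)) (proj₂ (whole-multiple whole)))) ⟩
    2 * m + 2 * c    ≡⟨ *-distribˡ-+ 2 m c ⟨
    2 * (m + c)      ≤⟨ *-monoʳ-≤ 2 (cost-bound T bst ordered opt) ⟩
    2 * cost opt     ∎
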